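{- Let $\gamma/\lambda$ be a skew shape. If $\mu=(\mu_1,\mu_2,\ldots)$ is a partition with $c^{\gamma}_{\lambda,\mu}\neq0$, then for all $i\ge1$, $$\partial_{(i)}(\gamma/\lambda)\le_{GDom}(\mu_{i+1},\mu_{i+2},\ldots).$$ Moreover, for $\mu=\partial_{(0)}(\gamma/\lambda)$ one has $c^{\gamma}_{\lambda,\mu}=1$; that is, $\partial_{(0)}(\gamma/\lambda)$ is the minimum partition $\mu$ with $c^{\gamma}_{\lambda,\mu}\neq0$ with respect to the generalized dominance order.
   Context: For partitions $\lambda\subseteq\gamma$ (with $\lambda$ padded by zeros), the skew shape $\gamma/\lambda$ is the set of cells $(i,j)$ (row $i$ from the top, column $j$ from the left) with $\lambda_i<j\le\gamma_i$. For a finite set $S$ of cells in the grid, $\uparrow_\leftarrow(S)$ denotes the partition obtained by listing the numbers of cells of $S$ in each row in non-increasing order (zeros discarded). For $i\ge1$, $\gamma/\lambda_{(i)}$ denotes the set of cells obtained from $\gamma/\lambda$ by deleting the top $i$ cells of each column (all cells of a column if it has at most $i$ cells). Lower derivations: $\partial_{(0)}(\gamma/\lambda)=\uparrow_\leftarrow(\gamma/\lambda)$ and, for $i\ge1$, $\partial_{(i)}(\gamma/\lambda)=\uparrow_\leftarrow(\gamma/\lambda_{(i)})$. Generalized dominance order: for a partition $\alpha=(\alpha_1,\ldots,\alpha_k)$ of $n$ and a partition $\beta=(\beta_1,\ldots,\beta_l)$ of $m$ with $n\le m$, $\alpha\le_{GDom}\beta$ means $\alpha_1+\cdots+\alpha_j\le\beta_1+\cdots+\beta_j$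 for all $1\le j\le\min\{k,l\}$. $c^{\gamma}_{\lambda,\mu}$ is the Littlewood–Richardson coefficient ($s_\lambda s_\mu=\sum_\gamma c^\gamma_{\lambda,\mu}s_\gamma$), equal to the number of Littlewood–Richardson tableaux of shape $\gamma/\lambda$ and content $\mu$, i.e. semi-standard tableaux of shape $\gamma/\lambda$ (rows weakly increasing left to right, columns strictly increasing downward) with $\mu_i$ labels equal to $i$, whose reverse row word (rows read right to left, top row first) is a lattice word (every prefix contains, for each $b\ge2$, at most as many $b$'s as $(b-1)$'s). -}

module Defs where

open import Data.Nat using (ℕ; zero; suc; _+_; _∸_; _≤_; _<_; _≥_; _≤?_; _<?_; _≟_; _⊔_)
open import Data.Nat.Properties using (≤-refl)
open import Data.Nat.ListAction using (sum)
open import Data.List using (List; []; _∷_; length; take; drop; filter; map; concat; concatMap; reverse; upTo; replicate)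
open import Data.List.Relation.Unary.All using (All; all?)
open import Data.List.Relation.Unary.Linked using (Linked; linked?)
open import Data.Product using (_×_; _,_)
open import Relation.Nullary using (Dec; yes; no)
open import Relation.Nullary.Decidable using (_×-dec_; _→-dec_)
open import Relation.Binary.PropositionalEquality using (_≡_)

-- λ_i with padding by zeros (rows are indexed from 0 here: row i of the
-- paper is index (i - 1)).
_!!_ : List ℕ → ℕ → ℕ
[] !! i = 0
(x ∷ xs) !! zero = x
(x ∷ xs) !! suc i = xs !! i

IsPartition : List ℕ → Set
IsPartition p = Linked _≥_ p × All (λ x → 1 ≤ x) p

_⊆ₚ_ : List ℕ → List ℕ → Set
l ⊆ₚ g = ∀ i → l !! i ≤ g !! i

∣_∣ₚ : List ℕ → ℕ
∣ p ∣ₚ = sum p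

-- Skew shapes γ/λ. A cell is (row r, column j); rows are 0-indexed,
-- columns 1-indexed: (r , j) ∈ γ/λ iff λ_r < j ≤ γ_r.

InSkew : List ℕ → List ℕ → ℕ → ℕ → Set
InSkew g l r j = (l !! r < j) × (j ≤ g !! r)

inSkew? : ∀ g l r j → Dec (InSkew g l r j)
inSkew? g l r j = ((l !! r) <? j) ×-dec (j ≤? (g !! r))

range : ℕ → ℕ → List ℕ
range a b = map (λ k → k + suc a) (upTo (b ∸ a))

countP : {P : ℕ → Set} → (∀ x → Dec (P x)) → List ℕ → ℕ
countP P? xs = length (filter P? xs)

insertDesc : ℕ → List ℕ → List ℕ
insertDesc x [] = x ∷ []
insertDesc x (y ∷ ys) with y ≤? x
... | yes _ = x ∷ y ∷ ys
... | no  _ = y ∷ insertDesc x ys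

sortDesc : List ℕ → List ℕ
sortDesc [] = []
sortDesc (x ∷ xs) = insertDesc x (sortDesc xs)

-- input: the list of numbers of cells of S in each row
↑← : List ℕ → List ℕ
↑← rows = sortDesc (filter (λ x → 1 ≤? x) rows)

cellsAbove : List ℕ → List ℕ → ℕ → ℕ → ℕ
cellsAbove g l r j = countP (λ r' → inSkew? g l r' j) (upTo r)

-- cell (r , j) belongs to γ/λ_(i): it lies in γ/λ and is not among the
-- top i cells of its column, i.e. at least i cells of column j lie above it.
InSkewCut : ℕ → List ℕ → List ℕ → ℕ → ℕ → Set
InSkewCut i g l r j = InSkew g l r j × (i ≤ cellsAbove g l r j)

inSkewCut? : ∀ i g l r j → Dec (InSkewCut i g l r j)
inSkewCut? i g l r j = inSkew? g l r j ×-dec (i ≤? cellsAbove g l r j)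

-- row counts of γ/λ_(i) (with i = 0 giving γ/λ itself);
-- all cells of γ/λ lie in rows 0 .. length γ - 1, columns 1 .. γ_0.
rowCountsCut : ℕ → List ℕ → List ℕ → List ℕ
rowCountsCut i g l =
  map (λ r → countP (λ j → inSkewCut? i g l r j) (range 0 (g !! r)))
      (upTo (length g))

∂ : ℕ → List ℕ → List ℕ → List ℕ
∂ i g l = ↑← (rowCountsCut i g l)

_≤GDom_ : List ℕ → List ℕ → Set
α ≤GDom β = (∣ α ∣ₚ ≤ ∣ β ∣ₚ) ×
  (∀ j → 1 ≤ j → j ≤ length α → j ≤ length β → sum (take j α) ≤ sum (take j β))

-- Littlewood–Richardson tableaux.
-- A filling of γ/λ is a list of rows; row r lists the labels of the
-- cells (r , λ_r + 1), …, (r , γ_r) from left to right.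

Filling : Set
Filling = List (List ℕ)

row : Filling → ℕ → List ℕ
row [] _ = []
row (x ∷ xs) zero = x
row (x ∷ xs) (suc k) = row xs k

entry : List ℕ → Filling → ℕ → ℕ → ℕ
entry l T r j = row T r !! (j ∸ suc (l !! r))

HasShape : List ℕ → List ℕ → Filling → Set
HasShape g l T = (length T ≡ length g) ×
  All (λ r → length (row T r) ≡ g !! r ∸ l !! r) (upTo (length g))

LabelsIn : List ℕ → Filling → Set
LabelsIn m T = All (All (λ x → (1 ≤ x) × (x ≤ length m))) T

RowsWeak : Filling → Set
RowsWeak T = All (Linked _≤_) T

ColsStrict : List ℕ → List ℕ → Filling → Set
ColsStrict g l T =
  All (λ r → All (λ j → InSkew g l r j → InSkew g l (suc r) j →
                        entry l T r j < entry l T (suc r) j)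
                 (range 0 (g !! r)))
      (upTo (length g))

HasContent : List ℕ → Filling → Set
HasContent m T =
  All (λ k → countP (k ≟_) (concat T) ≡ m !! (k ∸ 1)) (range 0 (length m))

revRowWord : Filling → List ℕ
revRowWord T = concat (map reverse T)

-- lattice word: every prefix has, for each b ≥ 2, at most as many b's as
-- (b−1)'s.  (Labels are ≤ ℓ(μ), so b ranges over 2 … ℓ(μ)+1; larger b
-- occur zero times.)
Lattice : ℕ → List ℕ → Set
Lattice k w =
  All (λ n → All (λ b → countP (b ≟_) (take n w) ≤ countP ((b ∸ 1) ≟_) (take n w))
                 (range 1 (suc k)))
      (upTo (suc (length w)))

IsLRTableau : List ℕ → List ℕ → List ℕ → Filling → Set
IsLRTableau g l m T =
  HasShape g l T × LabelsIn m T × RowsWeak T × ColsStrict g l T ×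
  HasContent m T × Lattice (length m) (revRowWord T)

isLRTableau? : ∀ g l m T → Dec (IsLRTableau g l m T)
isLRTableau? g l m T =
  ((length T ≟ length g) ×-dec all? (λ r → length (row T r) ≟ g !! r ∸ l !! r) (upTo (length g)))
  ×-dec (all? (all? (λ x → (1 ≤? x) ×-dec (x ≤? length m))) T
  ×-dec (all? (linked? _≤?_) T
  ×-dec (all? (λ r → all? (λ j → inSkew? g l r j →-dec (inSkew? g l (suc r) j →-dec
                                   (entry l T r j <? entry l T (suc r) j)))
                          (range 0 (g !! r)))
              (upTo (length g))
  ×-dec (all? (λ k → countP (k ≟_) (concat T) ≟ m !! (k ∸ 1)) (range 0 (length m))
  ×-dec all? (λ n → all? (λ b → countP (b ≟_) (take n (revRowWord T)) ≤? countP ((b ∸ 1) ≟_) (take n (revRowWord T)))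
                         (range 1 (suc (length m))))
             (upTo (suc (length (revRowWord T))))))))

words : ℕ → ℕ → List (List ℕ)
words zero k = [] ∷ []
words (suc n) k = concatMap (λ x → map (x ∷_) (words n k)) (range 0 k)

fillingsFrom : List ℕ → List ℕ → ℕ → ℕ → ℕ → List Filling
fillingsFrom g l k r zero = [] ∷ []
fillingsFrom g l k r (suc n) =
  concatMap (λ x → map (x ∷_) (fillingsFrom g l k (suc r) n))
            (words (g !! r ∸ l !! r) k)

fillings : List ℕ → List ℕ → ℕ → List Filling
fillings g l k = fillingsFrom g l k 0 (length g)

LR : List ℕ → List ℕ → List ℕ → ℕ
LR g l m = length (filter (isLRTableau? g l m) (fillings g l (length m)))

{-# OPTIONS --safe #-}
module Submission where

-- Reading a Littlewood–Richardson tableau row by row, the rows 0 … r contain at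
-- most as many labels b + 1 as the rows 0 … r - 1 contain labels b.  Telescoping
-- this inequality over b shows that any j rows together have at most
-- μ_{i+1} + … + μ_{i+j} labels exceeding i, while column strictness puts such a
-- label in every cell with at least i cells above it: this is the dominance.
-- For i = 0 it also applies to the first r rows.  If μ is the sorted list of row
-- lengths, the contents of the first r + 1 and of the first r rows interlace, and
-- dominance then forces the latter to be the former with one part, the length of
-- row r, removed.  By descending induction all label counts, hence the tableau,
-- are determined.  Labelling the cell of row r with x cells to its right by the
-- number of rows s ≤ r longer than x produces this tableau.

open import Defs
open import Data.List using (List; []; _∷_; _++_; length; take; drop; filter; map; concat; concatMap; reverse; upTo; applyUpTo; applyDownFrom; cartesianProductWith)
open import Data.List.Membership.Propositional using (_∈_)
open import Data.List.Membership.Propositional.Properties using (∈-cartesianProductWith⁺; ∈-map⁺; ∈-upTo⁺; ∈-filter⁺; ∈-filter⁻)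
open import Data.List.Properties using (∷-injective; ∷-injectiveˡ; ∷-injectiveʳ; ++-assoc; filter-accept; filter-reject; filter-none; filter-++; length-++; length-filter; length-applyUpTo; length-applyDownFrom; map-upTo; reverse-++; reverse-applyUpTo; take-[]; take-all; take++drop≡id; upTo-∷ʳ)
open import Data.List.Relation.Binary.Permutation.Propositional as ↭ using (_↭_; ↭-sym; ↭-refl; ↭-trans)
open import Data.List.Relation.Binary.Permutation.Propositional.Properties using (↭-reverse; filter-↭; ↭-length)
open import Data.List.Relation.Unary.All as All using (All; []; _∷_)
import Data.List.Relation.Unary.All.Properties as All
open import Data.List.Relation.Unary.AllPairs using ([]; _∷_)
open import Data.List.Relation.Unary.Any using (here; there)
open import Data.List.Relation.Unary.Linked as Linked using (Linked; []; [-]; _∷_)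
open import Data.List.Relation.Unary.Linked.Properties as Linked using (Linked⇒All)
open import Data.List.Relation.Unary.Unique.Propositional using (Unique)
open import Data.List.Relation.Unary.Unique.Propositional.Properties as Unique using (cartesianProductWith⁺; upTo⁺)
open import Data.Nat
open import Data.Nat.ListAction using (sum)
open import Data.Nat.ListAction.Properties using (sum-++; sum-↭)
open import Data.Nat.Properties
open import Algebra.Properties.CommutativeSemigroup +-commutativeSemigroup using (interchange; x∙yz≈y∙xz; xy∙z≈xz∙y)
open import Data.Product using (_×_; _,_; proj₁; proj₂; ∃; ∃₂)
open import Data.Sum using (_⊎_; inj₁; inj₂)
open import Function using (_∘_; id)
open import Relation.Nullary using (¬_; Dec; yes; no; contradiction)
open import Relation.Binary.PropositionalEquality using (_≡_; _≢_; refl; sym; trans; cong; cong₂; subst; subst₂; module ≡-Reasoning)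

-- Interlaced label counts

Σ< : ℕ → (ℕ → ℕ) → ℕ
Σ< zero    f = 0
Σ< (suc n) f = Σ< n f + f n

Σ<-0 : ∀ n → Σ< n (λ _ → 0) ≡ 0
Σ<-0 zero    = refl
Σ<-0 (suc n) = trans (+-identityʳ _) (Σ<-0 n)

Σ<-front : ∀ n f → Σ< (suc n) f ≡ f 0 + Σ< n (f ∘ suc)
Σ<-front zero    f = sym (+-identityʳ (f 0))
Σ<-front (suc n) f = trans (cong (_+ f (suc n)) (Σ<-front n f)) (+-assoc (f 0) _ _)

Σ<-cong-< : ∀ n {f g} → (∀ i → i < n → f i ≡ g i) → Σ< n f ≡ Σ< n g
Σ<-cong-< zero    e = refl
Σ<-cong-< (suc n) e = cong₂ _+_ (Σ<-cong-< n (λ i p → e i (m≤n⇒m≤1+n p))) (e n ≤-refl)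

Σ<-cong : ∀ n {f g} → (∀ i → f i ≡ g i) → Σ< n f ≡ Σ< n g
Σ<-cong n e = Σ<-cong-< n (λ i _ → e i)

Σ<-mono : ∀ n {f g} → (∀ i → f i ≤ g i) → Σ< n f ≤ Σ< n g
Σ<-mono zero    e = z≤n
Σ<-mono (suc n) e = +-mono-≤ (Σ<-mono n e) (e n)

Σ<-+ : ∀ n f g → Σ< n (λ i → f i + g i) ≡ Σ< n f + Σ< n g
Σ<-+ zero    f g = refl
Σ<-+ (suc n) f g = trans (cong (_+ (f n + g n)) (Σ<-+ n f g)) (interchange (Σ< n f) _ _ _)

Σ<-split : ∀ m n f → Σ< (m + n) f ≡ Σ< n f + Σ< m (λ i → f (i + n))
Σ<-split zero    n f = sym (+-identityʳ _)
Σ<-split (suc m) n f = trans (cong (_+ f (m + n)) (Σ<-split m n f)) (+-assoc (Σ< n f) _ _)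

Σ<-!! : ∀ n xs → Σ< n (xs !!_) ≡ sum (take n xs)
Σ<-!! zero    xs       = refl
Σ<-!! (suc n) []       = trans (+-identityʳ _) (trans (Σ<-!! n []) (cong sum (take-[] n)))
Σ<-!! (suc n) (x ∷ xs) = trans (Σ<-front n _) (cong (x +_) (Σ<-!! n xs))

drop-!! : ∀ i xs t → drop i xs !! t ≡ xs !! (t + i)
drop-!! zero    xs       t = cong (xs !!_) (sym (+-identityʳ t))
drop-!! (suc i) []       t = refl
drop-!! (suc i) (x ∷ xs) t = trans (drop-!! i xs t) (cong ((x ∷ xs) !!_) (sym (+-suc t i)))

-- c s b stands for the number of labels b + 1 in row s of a filling.
cumul : (ℕ → ℕ → ℕ) → ℕ → ℕ → ℕ
cumul c r b = Σ< r (λ s → c s b)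

-- The lattice condition read at row ends. Row `r` contributes on the left only: rows are read from
-- right to left, so its labels `b + 2` come before its labels `b + 1`.
Interlaced : (ℕ → ℕ → ℕ) → Set
Interlaced c = ∀ r b → cumul c (suc r) (suc b) ≤ cumul c r b

-- Telescoping over the labels: by induction for the shifted counts, the labels of row `r` beyond
-- the first number at most `cumul c (suc r) 1`, which interlacing bounds by `cumul c r 0`.
row≤cumul : ∀ c → Interlaced c → ∀ r m → Σ< m (c r) ≤ cumul c (suc r) 0
row≤cumul c I r zero    = z≤n
row≤cumul c I r (suc m) = begin
  Σ< (suc m) (c r)                           ≡⟨ Σ<-front m (c r) ⟩
  c r 0 + Σ< m (c r ∘ suc)                   ≤⟨ +-monoʳ-≤ (c r 0) (row≤cumul (λ s → c s ∘ suc) (λ r b → I r (suc b)) r m) ⟩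
  c r 0 + cumul c (suc r) 1                  ≤⟨ +-monoʳ-≤ (c r 0) (I r 0) ⟩
  c r 0 + cumul c r 0                        ≡⟨ +-comm (c r 0) _ ⟩
  cumul c (suc r) 0                          ∎
  where open ≤-Reasoning

-- The first `j` labels of the row are kept exactly; `row≤cumul` for the counts shifted by `j`
-- bounds the others.
row≤initial+cumul : ∀ c → Interlaced c → ∀ r m j → Σ< m (c r) ≤ Σ< j (c r) + cumul c (suc r) j
row≤initial+cumul c I r m j = begin
  -- Enlarging `m` to `m + j` permits the split at `j` without comparing `m` and `j`.
  Σ< m (c r)                                  ≤⟨ m≤m+n _ _ ⟩
  Σ< m (c r) + Σ< j (λ t → c r (t + m))       ≡⟨ Σ<-split j m (c r) ⟨
  Σ< (j + m) (c r)                            ≡⟨ cong (λ k → Σ< k (c r)) (+-comm j m) ⟩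
  Σ< (m + j) (c r)                            ≡⟨ Σ<-split m j (c r) ⟩
  Σ< j (c r) + Σ< m (λ t → c r (t + j))       ≤⟨ +-monoʳ-≤ (Σ< j (c r)) (row≤cumul (λ s b → c s (b + j)) (λ r b → I r (b + j)) r m) ⟩
  Σ< j (c r) + cumul c (suc r) j              ∎
  where open ≤-Reasoning

-- Either `x` lands behind the first `j` entries, or it is one of them and the others are leading
-- entries of `ys`. These are the two cases for the last row in an induction on rows.
take-insertDesc : ∀ j x ys →
  sum (take j (insertDesc x ys)) ≤ sum (take j ys) ⊎
  ∃ λ j′ → j ≡ suc j′ × sum (take j (insertDesc x ys)) ≤ x + sum (take j′ ys)
take-insertDesc zero    x ys = inj₁ z≤n
take-insertDesc (suc j) x [] = inj₂ (j , refl , +-monoʳ-≤ x (≤-reflexive refl))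
take-insertDesc (suc j) x (y ∷ ys) with y ≤? x
... | yes _ = inj₂ (j , refl , ≤-refl)
... | no  _ with take-insertDesc j x ys
...   | inj₁ p = inj₁ (+-monoʳ-≤ y p)
...   | inj₂ (j′ , refl , p) = inj₂ (j , refl ,
          ≤-trans (+-monoʳ-≤ y p) (≤-reflexive (x∙yz≈y∙xz y x _)))

↑←-accept : ∀ {x} xs → 1 ≤ x → ↑← (x ∷ xs) ≡ insertDesc x (↑← xs)
↑←-accept xs p = cong sortDesc (filter-accept (1 ≤?_) p)

↑←-reject : ∀ {x} xs → ¬ 1 ≤ x → ↑← (x ∷ xs) ≡ ↑← xs
↑←-reject xs p = cong sortDesc (filter-reject (1 ≤?_) p)

-- In the last of j selected rows, the labels up to j - 1 are accounted for by the
-- growth of the first j - 1 cumulative counts, the remaining ones by the j-th count.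
top-rows≤cumul : ∀ c d → Interlaced c → (∀ r → ∃ λ m → d r ≤ Σ< m (c r)) →
  ∀ r j → sum (take j (↑← (applyDownFrom d r))) ≤ Σ< j (cumul c r)
top-rows≤cumul c d I D zero zero = z≤n
top-rows≤cumul c d I D zero (suc j) = z≤n
top-rows≤cumul c d I D (suc r) j with 1 ≤? d r
... | no  n = begin
  sum (take j (↑← (d r ∷ applyDownFrom d r)))    ≡⟨ cong (sum ∘ take j) (↑←-reject (applyDownFrom d r) n) ⟩
  sum (take j (↑← (applyDownFrom d r)))          ≤⟨ top-rows≤cumul c d I D r j ⟩
  Σ< j (cumul c r)                               ≤⟨ Σ<-mono j (λ b → m≤m+n _ _) ⟩
  Σ< j (cumul c (suc r))                         ∎
  where open ≤-Reasoning
... | yes p with take-insertDesc j (d r) (↑← (applyDownFrom d r))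
...   | inj₁ q = begin
  sum (take j (↑← (d r ∷ applyDownFrom d r)))    ≡⟨ cong (sum ∘ take j) (↑←-accept (applyDownFrom d r) p) ⟩
  sum (take j (insertDesc (d r) (↑← (applyDownFrom d r)))) ≤⟨ q ⟩
  sum (take j (↑← (applyDownFrom d r)))          ≤⟨ top-rows≤cumul c d I D r j ⟩
  Σ< j (cumul c r)                               ≤⟨ Σ<-mono j (λ b → m≤m+n _ _) ⟩
  Σ< j (cumul c (suc r))                         ∎
  where open ≤-Reasoning
...   | inj₂ (i , refl , q) = begin
  sum (take j (↑← (d r ∷ applyDownFrom d r)))    ≡⟨ cong (sum ∘ take j) (↑←-accept (applyDownFrom d r) p) ⟩
  sum (take j (insertDesc (d r) (↑← (applyDownFrom d r)))) ≤⟨ q ⟩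
  d r + sum (take i (↑← (applyDownFrom d r)))    ≤⟨ +-mono-≤ (proj₂ (D r)) (top-rows≤cumul c d I D r i) ⟩
  Σ< m (c r) + Σ< i (cumul c r)                  ≤⟨ +-monoˡ-≤ _ (row≤initial+cumul c I r m i) ⟩
  Σ< i (c r) + cumul c (suc r) i + Σ< i (cumul c r) ≡⟨ xy∙z≈xz∙y (Σ< i (c r)) _ _ ⟩
  Σ< i (c r) + Σ< i (cumul c r) + cumul c (suc r) i ≡⟨ cong (_+ cumul c (suc r) i) (+-comm (Σ< i (c r)) _) ⟩
  Σ< i (cumul c r) + Σ< i (c r) + cumul c (suc r) i ≡⟨ cong (_+ cumul c (suc r) i) (Σ<-+ i (cumul c r) (c r)) ⟨
  Σ< j (cumul c (suc r))                         ∎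
  where open ≤-Reasoning
        m = proj₁ (D r)

-- Independence of sorting from the order of the rows

insertDesc-comm : ∀ x y zs → insertDesc x (insertDesc y zs) ≡ insertDesc y (insertDesc x zs)
insertDesc-comm x y [] with y ≤? x | x ≤? y
... | yes p | yes q with refl ← ≤-antisym p q = refl
... | yes p | no  q = refl
... | no  p | yes q = refl
... | no  p | no  q = contradiction (≰⇒≥ p) q
insertDesc-comm x y (z ∷ zs) with z ≤? x in ex | z ≤? y in ey
... | no  p | no  q rewrite ex | ey = cong (z ∷_) (insertDesc-comm x y zs)
... | yes p | yes q with y ≤? x | x ≤? y
...   | yes p′ | yes q′ with refl ← ≤-antisym p′ q′ = refl
...   | yes p′ | no  q′ rewrite ey = refl
...   | no  p′ | yes q′ rewrite ex = refl
...   | no  p′ | no  q′ = contradiction (≰⇒≥ p′) q′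
insertDesc-comm x y (z ∷ zs) | yes p | no q rewrite ex with x ≤? y
... | yes r = contradiction (≤-trans p r) q
... | no  r rewrite ey = refl
insertDesc-comm x y (z ∷ zs) | no p | yes q rewrite ey with y ≤? x
... | yes r = contradiction (≤-trans q r) p
... | no  r rewrite ex = refl

sortDesc-↭ : ∀ {xs ys} → xs ↭ ys → sortDesc xs ≡ sortDesc ys
sortDesc-↭ ↭.refl = refl
sortDesc-↭ (↭.prep x p) = cong (insertDesc x) (sortDesc-↭ p)
sortDesc-↭ (↭.swap {xs} x y p) = trans (insertDesc-comm x y (sortDesc xs)) (cong (insertDesc y ∘ insertDesc x) (sortDesc-↭ p))
sortDesc-↭ (↭.trans p q) = trans (sortDesc-↭ p) (sortDesc-↭ q)

-- Lower derivations list the rows from the top down, whereas `top-rows≤cumul` splits off the bottom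
-- row first; sorting makes the order immaterial.
↑←-upTo : ∀ d n → ↑← (map d (upTo n)) ≡ ↑← (applyDownFrom d n)
↑←-upTo d n = begin
  ↑← (map d (upTo n))             ≡⟨ cong ↑← (map-upTo d n) ⟩
  ↑← (applyUpTo d n)              ≡⟨ sortDesc-↭ (filter-↭ (1 ≤?_) (↭-sym (↭-reverse (applyUpTo d n)))) ⟩
  ↑← (reverse (applyUpTo d n))    ≡⟨ cong ↑← (reverse-applyUpTo d n) ⟩
  ↑← (applyDownFrom d n)          ∎
  where open ≡-Reasoning

-- Label counts of Littlewood–Richardson tableaux

[_] : {P : Set} → Dec P → ℕ
[ yes _ ] = 1
[ no _ ]  = 0

module _ {P : ℕ → Set} (P? : ∀ x → Dec (P x)) where

  countP-∷ : ∀ x xs → countP P? (x ∷ xs) ≡ [ P? x ] + countP P? xs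
  countP-∷ x xs with P? x
  ... | yes _ = refl
  ... | no  _ = refl

  countP-++ : ∀ xs ys → countP P? (xs ++ ys) ≡ countP P? xs + countP P? ys
  countP-++ xs ys = trans (cong length (filter-++ P? xs ys)) (length-++ (filter P? xs))

  countP-reverse : ∀ xs → countP P? (reverse xs) ≡ countP P? xs
  countP-reverse xs = ↭-length (filter-↭ P? (↭-reverse xs))

  countP-none : ∀ {xs} → All (λ x → ¬ P x) xs → countP P? xs ≡ 0
  countP-none = cong length ∘ filter-none P?

module _ {P Q R : ℕ → Set} (P? : ∀ x → Dec (P x)) (Q? : ∀ x → Dec (Q x)) (R? : ∀ x → Dec (R x)) where

  countP-≤-+ : (∀ x → [ P? x ] ≤ [ Q? x ] + [ R? x ]) → ∀ xs → countP P? xs ≤ countP Q? xs + countP R? xs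
  countP-≤-+ h []       = z≤n
  countP-≤-+ h (x ∷ xs) = begin
    countP P? (x ∷ xs)                                        ≡⟨ countP-∷ P? x xs ⟩
    [ P? x ] + countP P? xs                                   ≤⟨ +-mono-≤ (h x) (countP-≤-+ h xs) ⟩
    [ Q? x ] + [ R? x ] + (countP Q? xs + countP R? xs)       ≡⟨ interchange [ Q? x ] _ _ _ ⟩
    [ Q? x ] + countP Q? xs + ([ R? x ] + countP R? xs)       ≡⟨ cong₂ _+_ (countP-∷ Q? x xs) (countP-∷ R? x xs) ⟨
    countP Q? (x ∷ xs) + countP R? (x ∷ xs)                   ∎
    where open ≤-Reasoning

  countP-+-≤ : (∀ x → [ P? x ] + [ Q? x ] ≤ [ R? x ]) → ∀ xs → countP P? xs + countP Q? xs ≤ countP R? xs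
  countP-+-≤ h []       = z≤n
  countP-+-≤ h (x ∷ xs) = begin
    countP P? (x ∷ xs) + countP Q? (x ∷ xs)                   ≡⟨ cong₂ _+_ (countP-∷ P? x xs) (countP-∷ Q? x xs) ⟩
    [ P? x ] + countP P? xs + ([ Q? x ] + countP Q? xs)       ≡⟨ interchange [ P? x ] _ _ _ ⟩
    [ P? x ] + [ Q? x ] + (countP P? xs + countP Q? xs)       ≤⟨ +-mono-≤ (h x) (countP-+-≤ h xs) ⟩
    [ R? x ] + countP R? xs                                   ≡⟨ countP-∷ R? x xs ⟨
    countP R? (x ∷ xs)                                        ∎
    where open ≤-Reasoning

-- Each step splits off the smallest remaining label `i + 1`; the bound `m + i` on the entries
-- ensures that nothing is left after `m` steps.
countP-above≤ : ∀ m i xs → All (_≤ m + i) xs → countP (i <?_) xs ≤ Σ< m (λ t → countP (suc (t + i) ≟_) xs)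
countP-above≤ zero    i xs a = ≤-reflexive (countP-none (i <?_) (All.map ≤⇒≯ a))
countP-above≤ (suc m) i xs a = begin
  countP (i <?_) xs                                           ≤⟨ countP-≤-+ (i <?_) (suc i ≟_) (suc i <?_) split xs ⟩
  countP (suc i ≟_) xs + countP (suc i <?_) xs                ≤⟨ +-monoʳ-≤ (countP (suc i ≟_) xs) (countP-above≤ m (suc i) xs (subst (λ k → All (_≤ k) xs) (sym (+-suc m i)) a)) ⟩
  countP (suc i ≟_) xs + Σ< m (λ t → countP (suc (t + suc i) ≟_) xs)
    ≡⟨ cong (countP (suc i ≟_) xs +_) (Σ<-cong m (λ t → cong (λ k → countP (suc k ≟_) xs) (+-suc t i))) ⟩
  countP (suc i ≟_) xs + Σ< m (λ t → countP (suc (suc t + i) ≟_) xs)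
    ≡⟨ Σ<-front m (λ t → countP (suc (t + i) ≟_) xs) ⟨
  Σ< (suc m) (λ t → countP (suc (t + i) ≟_) xs)               ∎
  where
  open ≤-Reasoning
  split : ∀ x → [ i <? x ] ≤ [ suc i ≟ x ] + [ suc i <? x ]
  split x with i <? x | suc i ≟ x | suc i <? x
  ... | no  _ | _     | _     = z≤n
  ... | yes _ | yes _ | _     = s≤s z≤n
  ... | yes _ | no  _ | yes _ = ≤-refl
  ... | yes p | no  q | no  r = contradiction (≤∧≢⇒< p q) r

-- Different labels occupy different entries, so the counts of the labels 1 to `K` together fit
-- among the entries that are at most `K`.
Σ<-countP≤length : ∀ K xs → Σ< K (λ b → countP (suc b ≟_) xs) ≤ length xs
Σ<-countP≤length K xs = ≤-trans (below K) (length-filter (_≤? K) xs)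
  where

  join : ∀ K x → [ x ≤? K ] + [ suc K ≟ x ] ≤ [ x ≤? suc K ]
  join K x with x ≤? K | suc K ≟ x | x ≤? suc K
  ... | yes p | yes refl | _     = contradiction p 1+n≰n
  ... | yes _ | no  _    | yes _ = ≤-refl
  ... | yes p | no  _    | no q  = contradiction (m≤n⇒m≤1+n p) q
  ... | no  _ | yes _    | yes _ = ≤-refl
  ... | no  _ | yes refl | no q  = contradiction ≤-refl q
  ... | no  _ | no  _    | _     = z≤n
  below : ∀ K → Σ< K (λ b → countP (suc b ≟_) xs) ≤ countP (_≤? K) xs
  below zero    = z≤n
  below (suc K) = ≤-trans (+-monoˡ-≤ _ (below K)) (countP-+-≤ (_≤? K) (suc K ≟_) (_≤? suc K) (join K) xs)

-- Reading words and the lattice condition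

labels : Filling → ℕ → ℕ → ℕ
labels T s b = countP (suc b ≟_) (row T s)

countP-concat : ∀ {P : ℕ → Set} (P? : ∀ x → Dec (P x)) T →
  countP P? (concat T) ≡ Σ< (length T) (λ s → countP P? (row T s))
countP-concat P? []      = refl
countP-concat P? (x ∷ T) = trans (countP-++ P? x (concat T))
  (trans (cong (countP P? x +_) (countP-concat P? T)) (sym (Σ<-front (length T) _)))

-- Cuts the reading word around row `r`. The count for `pre` covers all predicates at once, because
-- two different labels are to be compared over the same prefix.
word-at-row : ∀ T r → ∃₂ λ pre post → revRowWord T ≡ (pre ++ reverse (row T r)) ++ post ×
  (∀ {P : ℕ → Set} (P? : ∀ x → Dec (P x)) → countP P? pre ≡ Σ< r (λ s → countP P? (row T s)))
word-at-row []      r       = [] , [] , refl , λ P? → sym (Σ<-0 r)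
word-at-row (x ∷ T) zero    = [] , revRowWord T , refl , λ P? → refl
word-at-row (x ∷ T) (suc r) with pre , post , eq , count ← word-at-row T r =
  reverse x ++ pre , post ,
  trans (cong (reverse x ++_) eq)
    (trans (sym (++-assoc (reverse x) _ post)) (cong (_++ post) (sym (++-assoc (reverse x) pre _)))) ,
  λ P? → trans (countP-++ P? (reverse x) pre)
    (trans (cong₂ _+_ (countP-reverse P? x) (count P?)) (sym (Σ<-front r _)))

++-compare : ∀ (xs : List ℕ) {ys p q} → xs ++ ys ≡ p ++ q →
  (∃ λ z → xs ≡ p ++ z) ⊎ (∃ λ z → p ≡ xs ++ z × ys ≡ z ++ q)
++-compare []       {p = p} eq = inj₂ (p , refl , eq)
++-compare (x ∷ xs) {p = []} eq = inj₁ (x ∷ xs , refl)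
++-compare (x ∷ xs) {p = y ∷ p} eq with refl ← ∷-injectiveˡ eq
  with ++-compare xs {p = p} (∷-injectiveʳ eq)

... | inj₁ (z , e)      = inj₁ (z , cong (x ∷_) e)
... | inj₂ (z , e , e′) = inj₂ (z , cong (x ∷_) e , e′)

-- The witness is the row in which the prefix breaks off. It is chosen before the predicate, so the
-- counts of two labels can be estimated at the same row.
prefix-between-rows : ∀ T p q → revRowWord T ≡ p ++ q → ∃ λ r → ∀ {P : ℕ → Set} (P? : ∀ x → Dec (P x)) →
  Σ< r (λ s → countP P? (row T s)) ≤ countP P? p × countP P? p ≤ Σ< (suc r) (λ s → countP P? (row T s))
prefix-between-rows []      []      q eq = 0 , λ P? → z≤n , z≤n
prefix-between-rows (x ∷ T) p       q eq with ++-compare (reverse x) {p = p} eq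
... | inj₁ (z , e) = 0 , λ P? → z≤n , (begin
  countP P? p                   ≤⟨ m≤m+n _ _ ⟩
  countP P? p + countP P? z     ≡⟨ countP-++ P? p z ⟨
  countP P? (p ++ z)            ≡⟨ cong (countP P?) e ⟨
  countP P? (reverse x)         ≡⟨ countP-reverse P? x ⟩
  countP P? x                   ∎)
  where open ≤-Reasoning
... | inj₂ (z , refl , e′) with r , between ← prefix-between-rows T z q e′ = suc r , λ P? →
  let eq′ = trans (countP-++ P? (reverse x) z) (cong (_+ countP P? z) (countP-reverse P? x)) in
  subst₂ _≤_ (sym (Σ<-front r _)) (sym eq′) (+-monoʳ-≤ (countP P? x) (proj₁ (between P?))) ,
  subst₂ _≤_ (sym eq′) (sym (Σ<-front (suc r) _)) (+-monoʳ-≤ (countP P? x) (proj₂ (between P?)))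

sorted-split : ∀ v {xs} → Linked _≤_ xs → ∃₂ λ lo hi → xs ≡ lo ++ hi × All (_≤ v) lo × All (v <_) hi
sorted-split v {[]} _ = [] , [] , refl , [] , []
sorted-split v {x ∷ xs} l with x ≤? v
... | no  p = [] , x ∷ xs , refl , [] , All.map (<-≤-trans (≰⇒> p)) (Linked⇒All ≤-trans ≤-refl l)
... | yes p with lo , hi , refl , a , b ← sorted-split v (Linked.tail l) = x ∷ lo , hi , refl , p ∷ a , b

take-length-++ : ∀ (p q : List ℕ) → take (length p) (p ++ q) ≡ p
take-length-++ []      q = refl
take-length-++ (x ∷ p) q = cong (x ∷_) (take-length-++ p q)

Lattice-prefix : ∀ k w → Lattice k w → ∀ p q → w ≡ p ++ q → ∀ b → b < k →
  countP (suc (suc b) ≟_) p ≤ countP (suc b ≟_) p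
Lattice-prefix k w L p q refl b b<k =
  subst (λ p → countP (suc (suc b) ≟_) p ≤ countP (suc b ≟_) p) (take-length-++ p q)
    -- `range 1 (suc k)` lists its labels in the form `b + 2` with `b < k`; the substitution
    -- restores `suc (suc b)`.
    (subst (λ c → countP (c ≟_) p′ ≤ countP ((c ∸ 1) ≟_) p′) (+-comm b 2)
      (All.applyUpTo⁻ id k (All.map⁻ (All.applyUpTo⁻ id _ L (s≤s (≤-trans (m≤m+n (length p) (length q)) (≤-reflexive (sym (length-++ p)))))))
        b<k))
  where p′ = take (length p) (p ++ q)

prefix-Lattice : ∀ k w → (∀ p q → w ≡ p ++ q → ∀ b → countP (suc (suc b) ≟_) p ≤ countP (suc b ≟_) p) → Lattice k w
prefix-Lattice k w h = All.applyUpTo⁺₂ id _ λ n → All.map⁺ (All.applyUpTo⁺₂ id k λ b →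
  subst (λ c → countP (c ≟_) (take n w) ≤ countP ((c ∸ 1) ≟_) (take n w)) (+-comm 2 b)
    (h (take n w) (drop n w) (sym (take++drop≡id n w)) b))

row-All : ∀ {P : ℕ → Set} {T} → All (All P) T → ∀ s → All P (row T s)
row-All []      s       = []
row-All (a ∷ _) zero    = a
row-All (_ ∷ a) (suc s) = row-All a s

row-Linked : ∀ {T} → RowsWeak T → ∀ s → Linked _≤_ (row T s)
row-Linked []      s       = []
row-Linked (a ∷ _) zero    = a
row-Linked (_ ∷ a) (suc s) = row-Linked a s

labels-zero : ∀ {k T} → All (All (_≤ k)) T → ∀ s b → k ≤ b → labels T s b ≡ 0
labels-zero a s b k≤b = countP-none (suc b ≟_)
  (All.map (λ { x≤k refl → 1+n≰n (≤-trans x≤k k≤b) }) (row-All a s))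

cumul-zero : ∀ {k T} → All (All (_≤ k)) T → ∀ r b → k ≤ b → cumul (labels T) r b ≡ 0
cumul-zero a zero    b p = refl
cumul-zero a (suc r) b p = cong₂ _+_ (cumul-zero a r b p) (labels-zero a r b p)

-- The prefix ending just after the last label b + 2 of row r contains no label b + 1 of that row.
Lattice⇒Interlaced : ∀ k T → All (All (_≤ k)) T → RowsWeak T → Lattice k (revRowWord T) → Interlaced (labels T)
Lattice⇒Interlaced k T a W L r b with b <? k
-- `Lattice k` tests labels up to `k + 1` only; the label `b + 2` is larger than that and does not
-- occur.
... | no  b≮k = ≤-trans (≤-reflexive (cumul-zero a (suc r) (suc b) (m≤n⇒m≤1+n (≮⇒≥ b≮k)))) z≤n
... | yes b<k
  with pre , post , eq , count ← word-at-row T r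
     | lo , hi , row≡ , lo≤ , hi> ← sorted-split (suc b) (row-Linked W r) = begin
  Σ< r (λ s → labels T s (suc b)) + countP (2+b ≟_) (row T r)      ≡⟨ cong₂ _+_ (sym (count (2+b ≟_))) row-hi ⟩
  countP (2+b ≟_) pre + countP (2+b ≟_) (reverse hi)               ≡⟨ countP-++ (2+b ≟_) pre (reverse hi) ⟨
  countP (2+b ≟_) (pre ++ reverse hi)                              ≤⟨ Lattice-prefix k _ L (pre ++ reverse hi) (reverse lo ++ post) word≡ b b<k ⟩
  countP (suc b ≟_) (pre ++ reverse hi)                            ≡⟨ countP-++ (suc b ≟_) pre (reverse hi) ⟩
  countP (suc b ≟_) pre + countP (suc b ≟_) (reverse hi)           ≡⟨ cong₂ _+_ (count (suc b ≟_)) hi-none ⟩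
  Σ< r (λ s → labels T s b) + 0                                    ≡⟨ +-identityʳ _ ⟩
  cumul (labels T) r b                                             ∎
  where
  open ≤-Reasoning
  2+b = suc (suc b)
  row-hi : countP (2+b ≟_) (row T r) ≡ countP (2+b ≟_) (reverse hi)
  row-hi = trans (cong (countP (2+b ≟_)) row≡) (trans (countP-++ (2+b ≟_) lo hi)
    (cong₂ _+_ (countP-none (2+b ≟_) (All.map (λ { p refl → 1+n≰n p }) lo≤)) (sym (countP-reverse (2+b ≟_) hi))))
  hi-none : countP (suc b ≟_) (reverse hi) ≡ 0
  hi-none = trans (countP-reverse (suc b ≟_) hi)
    (countP-none (suc b ≟_) (All.map (λ { p refl → 1+n≰n p }) hi>))
  word≡ : revRowWord T ≡ (pre ++ reverse hi) ++ reverse lo ++ post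
  word≡ = trans eq (trans (cong (λ z → (pre ++ z) ++ post) (trans (cong reverse row≡) (reverse-++ lo hi)))
    (trans (cong (_++ post) (sym (++-assoc pre (reverse hi) (reverse lo)))) (++-assoc (pre ++ reverse hi) _ post)))

-- A prefix ending in row `r` has at most the labels `b + 2` of the rows 0 ... r and at least the
-- labels `b + 1` of the rows 0 ... r - 1; interlacing compares exactly these two numbers.
Interlaced⇒Lattice : ∀ k T → Interlaced (labels T) → Lattice k (revRowWord T)
Interlaced⇒Lattice k T I = prefix-Lattice k _ λ p q eq b →
  let r , between = prefix-between-rows T p q eq in
  ≤-trans (proj₂ (between (suc (suc b) ≟_))) (≤-trans (I r b) (proj₁ (between (suc b ≟_))))

-- Lower derivations

rowCount : ℕ → List ℕ → List ℕ → ℕ → ℕ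
rowCount i g l r = countP (λ j → inSkewCut? i g l r j) (range 0 (g !! r))

∂-downFrom : ∀ i g l → ∂ i g l ≡ ↑← (applyDownFrom (rowCount i g l) (length g))
∂-downFrom i g l = ↑←-upTo (rowCount i g l) (length g)

!!-nonzero⇒< : ∀ xs r → 1 ≤ xs !! r → r < length xs
!!-nonzero⇒< (x ∷ xs) zero    p = s≤s z≤n
!!-nonzero⇒< (x ∷ xs) (suc r) p = s≤s (!!-nonzero⇒< xs r p)

!!-overflow : ∀ xs r → length xs ≤ r → xs !! r ≡ 0
!!-overflow []       r       p       = refl
!!-overflow (x ∷ xs) (suc r) (s≤s p) = !!-overflow xs r p

!!-antitone : ∀ {xs} → Linked _≥_ xs → ∀ r → xs !! suc r ≤ xs !! r
!!-antitone []      r       = z≤n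
!!-antitone [-]     r       = z≤n
!!-antitone (p ∷ a) zero    = p
!!-antitone (p ∷ a) (suc r) = !!-antitone a r

All-!! : ∀ {P : ℕ → Set} {xs} → All P xs → ∀ q → q < length xs → P (xs !! q)
All-!! (p ∷ a) zero    q<       = p
All-!! (p ∷ a) (suc q) (s≤s q<) = All-!! a q q<

module _ {P : ℕ → Set} (P? : ∀ x → Dec (P x)) {Q : ℕ → Set} (Q? : ∀ x → Dec (Q x)) where

  -- Translates columns of a row into positions in its list of labels: `xs` is aligned with the
  -- indices from `l` up to `n - 1`, and each index satisfying `P` is matched with an entry
  -- satisfying `Q`.
  countP-applyUpTo≤ : ∀ f n l xs → length xs ≡ n ∸ l → (∀ q → P (f q) → l ≤ q × Q (xs !! (q ∸ l))) →
    countP P? (applyUpTo f n) ≤ countP Q? xs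
  countP-applyUpTo≤ f zero    l       xs       len h = z≤n
  countP-applyUpTo≤ f (suc n) (suc l) xs       len h with P? (f 0)
  ... | yes p with () ← proj₁ (h 0 p)
  ... | no  _ = countP-applyUpTo≤ (f ∘ suc) n l xs len λ q p → s≤s⁻¹ (proj₁ (h (suc q) p)) , proj₂ (h (suc q) p)
  countP-applyUpTo≤ f (suc n) zero    (x ∷ xs) len h with P? (f 0) | Q? x
  ... | yes p | no ¬q = contradiction (proj₂ (h 0 p)) ¬q
  ... | yes p | yes _ = s≤s (countP-applyUpTo≤ (f ∘ suc) n 0 xs (suc-injective len) λ q p → z≤n , proj₂ (h (suc q) p))
  ... | no _  | yes _ = m≤n⇒m≤1+n (countP-applyUpTo≤ (f ∘ suc) n 0 xs (suc-injective len) λ q p → z≤n , proj₂ (h (suc q) p))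
  ... | no _  | no _  = countP-applyUpTo≤ (f ∘ suc) n 0 xs (suc-injective len) λ q p → z≤n , proj₂ (h (suc q) p)

module _ {P : ℕ → Set} (P? : ∀ x → Dec (P x)) where

  countP-interval : ∀ f n l → (∀ q → q < n → l ≤ q → P (f q)) → (∀ q → P (f q) → l ≤ q) →
    countP P? (applyUpTo f n) ≡ n ∸ l
  countP-interval f zero    l       h h′ = sym (0∸n≡0 l)
  countP-interval f (suc n) (suc l) h h′ with P? (f 0)
  ... | yes p with () ← h′ 0 p
  ... | no  _ = countP-interval (f ∘ suc) n l (λ q a b → h (suc q) (s≤s a) (s≤s b)) (λ q p → s≤s⁻¹ (h′ (suc q) p))
  countP-interval f (suc n) zero h h′ with P? (f 0)
  ... | no ¬p = contradiction (h 0 (s≤s z≤n) z≤n) ¬p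
  ... | yes _ = cong suc (countP-interval (f ∘ suc) n 0 (λ q a b → h (suc q) (s≤s a) z≤n) (λ _ _ → z≤n))

rowCount-0 : ∀ g l r → rowCount 0 g l r ≡ g !! r ∸ l !! r
rowCount-0 g l r = trans (cong (countP (inSkewCut? 0 g l r)) (map-upTo (_+ 1) (g !! r)))
  (countP-interval (inSkewCut? 0 g l r) (_+ 1) (g !! r) (l !! r)
    (λ q q<g l≤q → (subst (l !! r <_) (+-comm 1 q) (s≤s l≤q) , subst (_≤ g !! r) (+-comm 1 q) q<g) , z≤n)
    (λ q p → s≤s⁻¹ (subst (l !! r <_) (+-comm q 1) (proj₁ (proj₁ p)))))

cellsAbove-suc : ∀ g l r j → cellsAbove g l (suc r) j ≡ cellsAbove g l r j + [ inSkew? g l r j ]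
cellsAbove-suc g l r j = trans (cong (countP P?) (sym (upTo-∷ʳ r)))
  (trans (countP-++ P? (upTo r) (r ∷ []))
    (cong (cellsAbove g l r j +_) (trans (countP-∷ P? r []) (+-identityʳ _))))
  where
  P? : ∀ r′ → Dec (InSkew g l r′ j)
  P? r′ = inSkew? g l r′ j

inSkew?-left : ∀ g l r j → j ≤ l !! r → [ inSkew? g l r j ] ≡ 0
inSkew?-left g l r j j≤ with inSkew? g l r j
... | yes p = contradiction j≤ (<⇒≱ (proj₁ p))
... | no  _ = refl

-- Since `l` decreases, a column lying inside `l` in row `r` lies inside `l` in every higher row.
cellsAbove-zero : ∀ g l → Linked _≥_ l → ∀ r j → j ≤ l !! r → cellsAbove g l (suc r) j ≡ 0
cellsAbove-zero g l d zero    j j≤ = trans (cellsAbove-suc g l zero j) (inSkew?-left g l zero j j≤)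
cellsAbove-zero g l d (suc r) j j≤ = trans (cellsAbove-suc g l (suc r) j)
  (cong₂ _+_ (cellsAbove-zero g l d r j (≤-trans j≤ (!!-antitone d r))) (inSkew?-left g l (suc r) j j≤))

row-beyond : ∀ T r → length T ≤ r → row T r ≡ []
row-beyond []      r       p       = refl
row-beyond (_ ∷ T) (suc r) (s≤s p) = row-beyond T r p

-- Dominance for Littlewood-Richardson tableaux

module Tableau {g l m T} (pg : IsPartition g) (pl : IsPartition l) (t : IsLRTableau g l m T) where

  private
    shape   = proj₁ t
    labelsIn = proj₁ (proj₂ t)
    weak    = proj₁ (proj₂ (proj₂ t))
    strict  = proj₁ (proj₂ (proj₂ (proj₂ t)))
    content = proj₁ (proj₂ (proj₂ (proj₂ (proj₂ t))))
    lattice = proj₂ (proj₂ (proj₂ (proj₂ (proj₂ t))))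

  row-overflow : ∀ r → length g ≤ r → row T r ≡ []
  row-overflow r n≤r = row-beyond T r (subst (_≤ r) (sym (proj₁ shape)) n≤r)

  rows-weak : ∀ r → Linked _≤_ (row T r)
  rows-weak = row-Linked weak

  length-row : ∀ r → length (row T r) ≡ g !! r ∸ l !! r
  length-row r with r <? length g
  ... | yes r<n = All.applyUpTo⁻ id (length g) (proj₂ shape) r<n
  ... | no  r≮n = trans (cong length (row-overflow r (≮⇒≥ r≮n)))
                    (sym (trans (cong (_∸ l !! r) (!!-overflow g r (≮⇒≥ r≮n))) (0∸n≡0 (l !! r))))

  bounded : All (All (_≤ length m)) T
  bounded = All.map (All.map proj₂) labelsIn

  interlaced : Interlaced (labels T)
  interlaced = Lattice⇒Interlaced (length m) T bounded weak lattice

  cumul-content : ∀ b → cumul (labels T) (length g) b ≡ m !! b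
  cumul-content b with b <? length m
  ... | no  b≮k = trans (cumul-zero bounded (length g) b (≮⇒≥ b≮k)) (sym (!!-overflow m b (≮⇒≥ b≮k)))
  ... | yes b<k = begin
    cumul (labels T) (length g) b      ≡⟨ cong (λ n → cumul (labels T) n b) (proj₁ shape) ⟨
    cumul (labels T) (length T) b      ≡⟨ countP-concat (suc b ≟_) T ⟨
    countP (suc b ≟_) (concat T)       ≡⟨ subst (λ k → countP (k ≟_) (concat T) ≡ m !! (k ∸ 1)) (+-comm b 1)
                                            (All.applyUpTo⁻ id (length m) (All.map⁻ content) b<k) ⟩
    m !! b                             ∎
    where open ≡-Reasoning

  entry-positive : ∀ r j → InSkew g l r j → 1 ≤ entry l T r j
  entry-positive r (suc j) (s≤s l≤j , j<g) = All-!! (All.map proj₁ (row-All labelsIn r)) (j ∸ l !! r)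
    (subst (j ∸ l !! r <_) (sym (length-row r)) (∸-monoˡ-< j<g l≤j))

  -- Labels start at 1 and grow with every cell down a column. Columns are contiguous: as `g` and
  -- `l` decrease, a cell with no neighbour directly above has no cells above it at all.
  cellsAbove<entry : ∀ r j → InSkew g l r j → cellsAbove g l r j < entry l T r j
  cellsAbove<entry zero    j p = entry-positive zero j p
  cellsAbove<entry (suc r) (suc j) p = go (inSkew? g l r (suc j)) refl
    where
    j<g : suc j ≤ g !! r
    j<g = ≤-trans (proj₂ p) (!!-antitone (proj₁ pg) r)
    go : (d : Dec (InSkew g l r (suc j))) → inSkew? g l r (suc j) ≡ d → cellsAbove g l (suc r) (suc j) < entry l T (suc r) (suc j)
    go (yes q) e = ≤-trans (s≤s (≤-trans (≤-reflexive above) (cellsAbove<entry r (suc j) q)))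
      (subst (λ k → InSkew g l r k → InSkew g l (suc r) k → entry l T r k < entry l T (suc r) k) (+-comm j 1)
        (All.applyUpTo⁻ id (g !! r) (All.map⁻ (All.applyUpTo⁻ id (length g) strict
          (!!-nonzero⇒< g r (≤-trans (s≤s z≤n) j<g)))) j<g) q p)
      where
      above : cellsAbove g l (suc r) (suc j) ≡ suc (cellsAbove g l r (suc j))
      above = trans (cellsAbove-suc g l r (suc j)) (trans (cong (λ d → cellsAbove g l r (suc j) + [ d ]) e) (+-comm _ 1))
    go (no ¬q) e = subst (_< entry l T (suc r) (suc j))
      (sym (cellsAbove-zero g l (proj₁ pl) r (suc j) (≮⇒≥ λ l<j → ¬q (l<j , j<g)))) (entry-positive (suc r) (suc j) p)

  -- A cell surviving the deletion has at least `i` cells above it, so `cellsAbove<entry` gives it a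
  -- label exceeding `i`.
  rowCount≤labels-above : ∀ i r → rowCount i g l r ≤ countP (i <?_) (row T r)
  rowCount≤labels-above i r = ≤-trans (≤-reflexive (cong (countP (inSkewCut? i g l r)) (map-upTo (_+ 1) (g !! r))))
    (countP-applyUpTo≤ (inSkewCut? i g l r) (i <?_) (_+ 1) (g !! r) (l !! r) (row T r) (length-row r) above)
    where
    above : ∀ q → InSkewCut i g l r (q + 1) → l !! r ≤ q × i < row T r !! (q ∸ l !! r)
    above q p with q + 1 | +-comm q 1
    ... | _ | refl = s≤s⁻¹ (proj₁ (proj₁ p)) , ≤-<-trans (proj₂ p) (cellsAbove<entry r (suc q) (proj₁ p))

  labels-above≤ : ∀ i r → countP (i <?_) (row T r) ≤ Σ< (length m) (λ t → labels T r (t + i))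
  labels-above≤ i r = countP-above≤ (length m) i (row T r) (All.map (λ p → ≤-trans p (m≤m+n _ i)) (row-All bounded r))

  -- Discarding the labels 1 to `i` leaves interlaced counts, and each row keeps at least
  -- `rowCount i g l r` labels, so `top-rows≤cumul` applies. Over all rows the shifted counts are
  -- the content with its first `i` parts dropped.
  ∂-dominated : ∀ i j → sum (take j (∂ i g l)) ≤ sum (take j (drop i m))
  ∂-dominated i j = begin
    sum (take j (∂ i g l))                                                ≡⟨ cong (sum ∘ take j) (∂-downFrom i g l) ⟩
    sum (take j (↑← (applyDownFrom (rowCount i g l) (length g))))         ≤⟨ top-rows≤cumul (λ r b → labels T r (b + i)) (rowCount i g l)
                                                                                (λ r b → interlaced r (b + i))
                                                                                (λ r → length m , ≤-trans (rowCount≤labels-above i r) (labels-above≤ i r))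
                                                                                (length g) j ⟩
    Σ< j (λ b → cumul (labels T) (length g) (b + i))                      ≡⟨ Σ<-cong j (λ b → trans (cumul-content (b + i)) (sym (drop-!! i m b))) ⟩
    Σ< j (drop i m !!_)                                                   ≡⟨ Σ<-!! j (drop i m) ⟩
    sum (take j (drop i m))                                               ∎
    where open ≤-Reasoning

  ∂≤GDom : ∀ i → ∂ i g l ≤GDom drop i m
  ∂≤GDom i = (begin
    -- The sizes are compared by taking for `j` the full length of the derivation.
    sum (∂ i g l)                             ≡⟨ cong sum (take-all (length (∂ i g l)) (∂ i g l) ≤-refl) ⟨
    sum (take (length (∂ i g l)) (∂ i g l))   ≤⟨ ∂-dominated i (length (∂ i g l)) ⟩
    sum (take (length (∂ i g l)) (drop i m))  ≤⟨ sum-take≤ (length (∂ i g l)) (drop i m) ⟩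
    sum (drop i m)                            ∎) ,
    λ j _ _ _ → ∂-dominated i j
    where
    open ≤-Reasoning
    sum-take≤ : ∀ n xs → sum (take n xs) ≤ sum xs
    sum-take≤ n xs = ≤-trans (m≤m+n _ (sum (drop n xs)))
      (≤-reflexive (trans (sym (sum-++ (take n xs) (drop n xs))) (cong sum (take++drop≡id n xs))))

-- The minimal tableau

[]-cong : {P Q : Set} (P? : Dec P) (Q? : Dec Q) → (P → Q) → (Q → P) → [ P? ] ≡ [ Q? ]
[]-cong (yes p) (yes q) f g = refl
[]-cong (yes p) (no ¬q) f g = contradiction (f p) ¬q
[]-cong (no ¬p) (yes q) f g = contradiction (g q) ¬p
[]-cong (no ¬p) (no ¬q) f g = refl

-- Expresses a part as the number of columns it reaches, so that identities between parts can be
-- proved column by column through the conjugate.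
Σ<-[<] : ∀ y M → y ≤ M → Σ< M (λ x → [ x <? y ]) ≡ y
Σ<-[<] zero zero    p = refl
Σ<-[<] y    (suc M) p with M <? y
... | no  M≮y = trans (+-identityʳ _) (Σ<-[<] y M (≮⇒≥ M≮y))
... | yes M<y with refl ← ≤-antisym p M<y = trans (+-comm _ 1) (cong suc
        (trans (Σ<-cong-< M (λ x x<M → []-cong (x <? suc M) (x <? M) (λ _ → x<M) m≤n⇒m≤1+n)) (Σ<-[<] M M ≤-refl)))

insertDesc-↭ : ∀ x ys → insertDesc x ys ↭ x ∷ ys
insertDesc-↭ x [] = ↭-refl
insertDesc-↭ x (y ∷ ys) with y ≤? x
... | yes _ = ↭-refl
... | no  _ = ↭-trans (↭.prep y (insertDesc-↭ x ys)) (↭.swap y x ↭-refl)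

sortDesc-self : ∀ xs → sortDesc xs ↭ xs
sortDesc-self []       = ↭-refl
sortDesc-self (x ∷ xs) = ↭-trans (insertDesc-↭ x (sortDesc xs)) (↭.prep x (sortDesc-self xs))

insertDesc-sorted : ∀ x {ys} → Linked _≥_ ys → Linked _≥_ (insertDesc x ys)
insertDesc-sorted x [] = [-]
insertDesc-sorted x {y ∷ _} [-] with y ≤? x
... | yes p = p ∷ [-]
... | no  p = ≰⇒≥ p ∷ [-]
insertDesc-sorted x {y ∷ z ∷ _} (q ∷ l) with y ≤? x
... | yes p = p ∷ q ∷ l
... | no  p with insertDesc-sorted x l
...   | ih with z ≤? x
...     | yes _ = ≰⇒≥ p ∷ ih
...     | no  _ = q ∷ ih

sortDesc-sorted : ∀ xs → Linked _≥_ (sortDesc xs)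
sortDesc-sorted []       = []
sortDesc-sorted (x ∷ xs) = insertDesc-sorted x (sortDesc-sorted xs)

countP-<-filter : ∀ x xs → countP (x <?_) (filter (1 ≤?_) xs) ≡ countP (x <?_) xs
countP-<-filter x []       = refl
countP-<-filter x (y ∷ xs) with 1 ≤? y
... | yes p = begin
  countP (x <?_) (filter (1 ≤?_) (y ∷ xs))       ≡⟨ cong (countP (x <?_)) (filter-accept (1 ≤?_) p) ⟩
  countP (x <?_) (y ∷ filter (1 ≤?_) xs)         ≡⟨ countP-∷ (x <?_) y _ ⟩
  [ x <? y ] + countP (x <?_) (filter (1 ≤?_) xs) ≡⟨ cong ([ x <? y ] +_) (countP-<-filter x xs) ⟩
  [ x <? y ] + countP (x <?_) xs                 ≡⟨ countP-∷ (x <?_) y xs ⟨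
  countP (x <?_) (y ∷ xs)                        ∎
  where open ≡-Reasoning
... | no  p = begin
  countP (x <?_) (filter (1 ≤?_) (y ∷ xs))       ≡⟨ cong (countP (x <?_)) (filter-reject (1 ≤?_) p) ⟩
  countP (x <?_) (filter (1 ≤?_) xs)             ≡⟨ countP-<-filter x xs ⟩
  countP (x <?_) xs                              ≡⟨ cong length (filter-reject (x <?_) (λ x<y → p (≤-trans (s≤s z≤n) x<y))) ⟨
  countP (x <?_) (y ∷ xs)                        ∎
  where open ≡-Reasoning

-- Discarded zeros never exceed `x` and sorting only permutes, so the conjugate can be read off the
-- unsorted row lengths.
countP-<-↑← : ∀ x xs → countP (x <?_) (↑← xs) ≡ countP (x <?_) xs
countP-<-↑← x xs = trans (↭-length (filter-↭ (x <?_) (sortDesc-self (filter (1 ≤?_) xs)))) (countP-<-filter x xs)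

sum-↑← : ∀ xs → sum (↑← xs) ≡ sum xs
sum-↑← xs = trans (sum-↭ (sortDesc-self (filter (1 ≤?_) xs))) (sum-filter xs)
  where
  sum-filter : ∀ xs → sum (filter (1 ≤?_) xs) ≡ sum xs
  sum-filter []       = refl
  sum-filter (y ∷ xs) with 1 ≤? y
  ... | yes p = trans (cong sum (filter-accept (1 ≤?_) p)) (cong (y +_) (sum-filter xs))
  ... | no  p = trans (cong sum (filter-reject (1 ≤?_) p))
                  (trans (sum-filter xs) (cong (_+ sum xs) (sym (n<1⇒n≡0 (≰⇒> p)))))

-- Conjugation: the number of parts exceeding x, and the parts themselves, determine each other.
<countP⇒<!! : ∀ {ys} → Linked _≥_ ys → ∀ x b → b < countP (x <?_) ys → x < ys !! b
<countP⇒<!! {y ∷ ys} l x b p with x <? y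
<countP⇒<!! {y ∷ ys} l x zero    p | yes x<y = x<y
<countP⇒<!! {y ∷ ys} l x (suc b) p | yes x<y = <countP⇒<!! (Linked.tail l) x b (s≤s⁻¹ (subst (suc b <_) (cong length (filter-accept (x <?_) x<y)) p))
<countP⇒<!! {y ∷ ys} l x b p | no x≮y = contradiction
  (subst (b <_) (countP-none (x <?_) (All.map (λ z≤y x<z → x≮y (<-≤-trans x<z z≤y)) (Linked⇒All (λ p q → ≤-trans q p) ≤-refl l))) p) λ ()

<!!⇒<countP : ∀ {ys} → Linked _≥_ ys → ∀ x b → x < ys !! b → b < countP (x <?_) ys
<!!⇒<countP {y ∷ ys} l x zero    x<y = subst (0 <_) (sym (cong length (filter-accept (x <?_) x<y))) (s≤s z≤n)
<!!⇒<countP {y ∷ ys} l x (suc b) p = subst (suc b <_) (sym (cong length (filter-accept (x <?_) (<-≤-trans p (!!≤head b)))))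
  (s≤s (<!!⇒<countP (Linked.tail l) x b p))
  where
  !!≤head : ∀ b → (y ∷ ys) !! suc b ≤ y
  !!≤head zero    = !!-antitone l zero
  !!≤head (suc b) = ≤-trans (!!-antitone l (suc b)) (!!≤head b)

countP-mono : {P Q : ℕ → Set} (P? : ∀ x → Dec (P x)) (Q? : ∀ x → Dec (Q x)) → (∀ x → P x → Q x) →
  ∀ xs → countP P? xs ≤ countP Q? xs
countP-mono P? Q? h []       = z≤n
countP-mono P? Q? h (x ∷ xs) with P? x | Q? x
... | yes p | no ¬q = contradiction (h x p) ¬q
... | yes _ | yes _ = s≤s (countP-mono P? Q? h xs)
... | no _  | yes _ = m≤n⇒m≤1+n (countP-mono P? Q? h xs)
... | no _  | no _  = countP-mono P? Q? h xs

countP-applyDownFrom : {P : ℕ → Set} (P? : ∀ x → Dec (P x)) → ∀ f n →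
  countP P? (applyDownFrom f n) ≡ Σ< n (λ x → [ P? (f x) ])
countP-applyDownFrom P? f zero    = refl
countP-applyDownFrom P? f (suc n) = trans (countP-∷ P? (f n) _)
  (trans (+-comm [ P? (f n) ] _) (cong (_+ [ P? (f n) ]) (countP-applyDownFrom P? f n)))

applyDownFrom-!! : ∀ f n q → q < n → applyDownFrom f n !! q ≡ f (n ∸ suc q)
applyDownFrom-!! f (suc n) zero    p       = refl
applyDownFrom-!! f (suc n) (suc q) (s≤s p) = applyDownFrom-!! f n q p

<-refining⇒≤ : ∀ {a b} → (∀ x → x < a → x < b) → a ≤ b
<-refining⇒≤ {zero}  h = z≤n
<-refining⇒≤ {suc a} h = h a ≤-refl

-- Contents of the initial rows and their conjugates

module Minimal (ℓ : ℕ → ℕ) where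

  -- The content intended for the rows 0 ... r - 1; `cumul-minRow` confirms it.
  part : ℕ → List ℕ
  part r = ↑← (applyDownFrom ℓ r)

  part-sorted : ∀ r → Linked _≥_ (part r)
  part-sorted r = sortDesc-sorted (filter (1 ≤?_) (applyDownFrom ℓ r))

  -- The parts of the conjugate of `part r`.
  conj : ℕ → ℕ → ℕ
  conj r x = countP (x <?_) (applyDownFrom ℓ r)

  -- The cell of row r with x cells to its right is labelled by the number of
  -- rows, from the top down to r, with more than x cells.
  minRow : ℕ → List ℕ
  minRow r = applyDownFrom (conj (suc r)) (ℓ r)

  conj-suc : ∀ r x → conj (suc r) x ≡ [ x <? ℓ r ] + conj r x
  conj-suc r x = countP-∷ (x <?_) (ℓ r) (applyDownFrom ℓ r)

  conj-suc-< : ∀ r x → x < ℓ r → conj (suc r) x ≡ suc (conj r x)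
  conj-suc-< r x p = cong length (filter-accept (x <?_) p)

  conj-suc-≮ : ∀ r x → ¬ x < ℓ r → conj (suc r) x ≡ conj r x
  conj-suc-≮ r x p = cong length (filter-reject (x <?_) p)

  conj-antitone : ∀ r {x y} → x ≤ y → conj r y ≤ conj r x
  conj-antitone r x≤y = countP-mono _ _ (λ _ → ≤-<-trans x≤y) (applyDownFrom ℓ r)

  conj-mono : ∀ {r n} → r ≤ n → ∀ x → conj r x ≤ conj n x
  conj-mono {n = zero}  z≤n x = ≤-refl
  conj-mono {r} {suc n} p   x with m≤n⇒m<n∨m≡n p
  ... | inj₂ refl = ≤-refl
  ... | inj₁ q = ≤-trans (conj-mono (s≤s⁻¹ q) x) (≤-trans (m≤n+m _ _) (≤-reflexive (sym (conj-suc n x))))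

  <conj⇒<part : ∀ r x b → b < conj r x → x < part r !! b
  <conj⇒<part r x b p = <countP⇒<!! (part-sorted r) x b (subst (b <_) (sym (countP-<-↑← x (applyDownFrom ℓ r))) p)

  <part⇒<conj : ∀ r x b → x < part r !! b → b < conj r x
  <part⇒<conj r x b p = subst (b <_) (countP-<-↑← x (applyDownFrom ℓ r)) (<!!⇒<countP (part-sorted r) x b p)

  -- Both parts are counted column by column. For `x < ℓ r` the conjugate grows by one, so part `b`
  -- gains column `x` exactly when the new value is `b + 1`, the label of the cell with `x` cells to
  -- its right. Other columns do not change.
  part-suc : ∀ r b → part (suc r) !! b ≡ part r !! b + countP (suc b ≟_) (minRow r)
  part-suc r b = begin
    -- The range `m + n` exceeds neither too little for `A` nor for `A′`: it bounds both, and it can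
    -- be cut at the row length `n`.
    A′                                                           ≡⟨ Σ<-[<] A′ (m + n) (≤-trans (m≤n+m A′ A) (m≤m+n m n)) ⟨
    Σ< (m + n) (λ x → [ x <? A′ ])                               ≡⟨ Σ<-split m n _ ⟩
    Σ< n (λ x → [ x <? A′ ]) + Σ< m (λ x → [ x + n <? A′ ])      ≡⟨ cong₂ _+_ (Σ<-cong-< n inside) (Σ<-cong m (λ x → outside (x + n) (m≤n+m n x))) ⟩
    Σ< n (λ x → [ x <? A ] + [ suc b ≟ conj (suc r) x ]) + Σ< m (λ x → [ x + n <? A ])
      ≡⟨ cong (_+ Σ< m (λ x → [ x + n <? A ])) (Σ<-+ n _ _) ⟩
    Σ< n (λ x → [ x <? A ]) + C + Σ< m (λ x → [ x + n <? A ])    ≡⟨ xy∙z≈xz∙y (Σ< n (λ x → [ x <? A ])) C _ ⟩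
    Σ< n (λ x → [ x <? A ]) + Σ< m (λ x → [ x + n <? A ]) + C    ≡⟨ cong (_+ C) (Σ<-split m n _) ⟨
    Σ< (m + n) (λ x → [ x <? A ]) + C                            ≡⟨ cong₂ _+_ (Σ<-[<] A (m + n) (≤-trans (m≤m+n A A′) (m≤m+n m n)))
                                                                     (sym (countP-applyDownFrom (suc b ≟_) (conj (suc r)) n)) ⟩
    A + countP (suc b ≟_) (minRow r)                             ∎
    where
    open ≡-Reasoning
    A = part r !! b
    A′ = part (suc r) !! b
    m = A + A′
    n = ℓ r
    C = Σ< n (λ x → [ suc b ≟ conj (suc r) x ])
    via-conj : ∀ r x → [ x <? part r !! b ] ≡ [ b <? conj r x ]
    via-conj r x = []-cong _ _ (<part⇒<conj r x b) (<conj⇒<part r x b)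
    step : ∀ k → [ b <? suc k ] ≡ [ b <? k ] + [ suc b ≟ suc k ]
    step k with b <? suc k | b <? k | suc b ≟ suc k
    ... | yes _ | yes p | yes refl = contradiction p 1+n≰n
    ... | yes _ | yes _ | no _ = refl
    ... | yes _ | no _  | yes _ = refl
    ... | yes p | no q  | no e = contradiction (cong suc (≤-antisym (s≤s⁻¹ p) (≮⇒≥ q))) e
    ... | no p  | yes q | _ = contradiction (m≤n⇒m≤1+n q) p
    ... | no p  | no _  | yes refl = contradiction ≤-refl p
    ... | no _  | no _  | no _ = refl
    inside : ∀ x → x < n → [ x <? A′ ] ≡ [ x <? A ] + [ suc b ≟ conj (suc r) x ]
    inside x x<n = begin
      [ x <? A′ ]                                           ≡⟨ via-conj (suc r) x ⟩
      [ b <? conj (suc r) x ]                               ≡⟨ cong (λ k → [ b <? k ]) (conj-suc-< r x x<n) ⟩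
      [ b <? suc (conj r x) ]                               ≡⟨ step (conj r x) ⟩
      [ b <? conj r x ] + [ suc b ≟ suc (conj r x) ]        ≡⟨ cong₂ _+_ (via-conj r x) (cong (λ k → [ suc b ≟ k ]) (conj-suc-< r x x<n)) ⟨
      [ x <? A ] + [ suc b ≟ conj (suc r) x ]               ∎
    outside : ∀ x → n ≤ x → [ x <? A′ ] ≡ [ x <? A ]
    outside x n≤x = trans (via-conj (suc r) x)
      (trans (cong (λ k → [ b <? k ]) (conj-suc-≮ r x (≤⇒≯ n≤x))) (sym (via-conj r x)))

  cumul-minRow : ∀ r b → cumul (λ s b → countP (suc b ≟_) (minRow s)) r b ≡ part r !! b
  cumul-minRow zero    b = refl
  cumul-minRow (suc r) b = trans (cong (_+ countP (suc b ≟_) (minRow r)) (cumul-minRow r b)) (sym (part-suc r b))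

  -- Adding one row raises each part of the conjugate by at most one.
  part-interlaced : ∀ r b → part (suc r) !! suc b ≤ part r !! b
  part-interlaced r b = <-refining⇒≤ λ x p → <conj⇒<part r x b (s≤s⁻¹ (≤-trans (<part⇒<conj (suc r) x (suc b) p) (conj≤ x)))
    where
    conj≤ : ∀ x → conj (suc r) x ≤ suc (conj r x)
    conj≤ x with x <? ℓ r
    ... | yes p = ≤-reflexive (conj-suc-< r x p)
    ... | no  p = m≤n⇒m≤1+n (≤-reflexive (conj-suc-≮ r x p))

  sum-part-suc : ∀ r → sum (part (suc r)) ≡ ℓ r + sum (part r)
  sum-part-suc r = trans (sum-↑← (applyDownFrom ℓ (suc r))) (cong (ℓ r +_) (sym (sum-↑← (applyDownFrom ℓ r))))

row-applyUpTo : ∀ f n r → r < n → row (applyUpTo f n) r ≡ f r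
row-applyUpTo f (suc n) zero    p       = refl
row-applyUpTo f (suc n) (suc r) (s≤s p) = row-applyUpTo (f ∘ suc) n r p

row-applyUpTo-≥ : ∀ f n r → n ≤ r → row (applyUpTo f n) r ≡ []
row-applyUpTo-≥ f zero    r       p       = refl
row-applyUpTo-≥ f (suc n) (suc r) (s≤s p) = row-applyUpTo-≥ (f ∘ suc) n r p

module MinimalTableau {g l} (pg : IsPartition g) (pl : IsPartition l) where

  open Minimal (rowCount 0 g l)

  private
    n = length g
    m = ∂ 0 g l
    ℓ = rowCount 0 g l

  T₀ : Filling
  T₀ = applyUpTo minRow n

  row-T₀ : ∀ r → row T₀ r ≡ minRow r
  row-T₀ r with r <? n
  ... | yes p = row-applyUpTo minRow n r p
  ... | no  p = trans (row-applyUpTo-≥ minRow n r (≮⇒≥ p))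
                  (cong (applyDownFrom (conj (suc r))) (sym (trans (rowCount-0 g l r)
                    (trans (cong (_∸ l !! r) (!!-overflow g r (≮⇒≥ p))) (0∸n≡0 (l !! r))))))

  cumul-T₀ : ∀ r b → cumul (labels T₀) r b ≡ part r !! b
  cumul-T₀ r b = trans (Σ<-cong r (λ s → cong (countP (suc b ≟_)) (row-T₀ s))) (cumul-minRow r b)

  -- The cell in column `j` of row `r` has `g !! r ∸ j` cells to its right.
  entry-T₀ : ∀ r j → InSkew g l r j → entry l T₀ r j ≡ conj (suc r) (g !! r ∸ j)
  entry-T₀ r (suc j) (s≤s l≤j , j<g) = begin
    row T₀ r !! (j ∸ l !! r)                       ≡⟨ cong (_!! (j ∸ l !! r)) (row-T₀ r) ⟩
    minRow r !! (j ∸ l !! r)                       ≡⟨ applyDownFrom-!! (conj (suc r)) (ℓ r) (j ∸ l !! r)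
                                                        (subst (j ∸ l !! r <_) (sym (rowCount-0 g l r)) (∸-monoˡ-< j<g l≤j)) ⟩
    conj (suc r) (ℓ r ∸ suc (j ∸ l !! r))          ≡⟨ cong (conj (suc r)) (begin
      ℓ r ∸ suc (j ∸ l !! r)                         ≡⟨ cong (_∸ suc (j ∸ l !! r)) (rowCount-0 g l r) ⟩
      g !! r ∸ l !! r ∸ suc (j ∸ l !! r)             ≡⟨ ∸-+-assoc (g !! r) (l !! r) _ ⟩
      g !! r ∸ (l !! r + suc (j ∸ l !! r))           ≡⟨ cong (g !! r ∸_) (trans (+-suc (l !! r) _) (cong suc (m+[n∸m]≡n l≤j))) ⟩
      g !! r ∸ suc j                                 ∎) ⟩
    conj (suc r) (g !! r ∸ suc j)                  ∎
    where open ≡-Reasoning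

  -- As `g` decreases, the lower cell has at most as many cells to its right, so no row is lost from
  -- the count; row `r + 1` itself is gained.
  T₀-cols : ∀ r j → InSkew g l r j → InSkew g l (suc r) j → entry l T₀ r j < entry l T₀ (suc r) j
  T₀-cols r j p q = begin-strict
    entry l T₀ r j                                 ≡⟨ entry-T₀ r j p ⟩
    conj (suc r) (g !! r ∸ j)                      ≤⟨ conj-antitone (suc r) (∸-monoˡ-≤ j (!!-antitone (proj₁ pg) r)) ⟩
    conj (suc r) (g !! suc r ∸ j)                  <⟨ n<1+n _ ⟩
    suc (conj (suc r) (g !! suc r ∸ j))            ≡⟨ conj-suc-< (suc r) _ (subst (g !! suc r ∸ j <_) (sym (rowCount-0 g l (suc r))) (∸-monoʳ-< (proj₁ q) (proj₂ q))) ⟨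
    conj (suc (suc r)) (g !! suc r ∸ j)            ≡⟨ entry-T₀ (suc r) j q ⟨
    entry l T₀ (suc r) j                           ∎
    where open ≤-Reasoning

  -- Row `r` itself is always counted, and at most all nonempty rows are, whose number is the length
  -- of `m`.
  T₀-labels : ∀ {r} → r < n → All (λ x → 1 ≤ x × x ≤ length m) (minRow r)
  T₀-labels {r} r<n = All.applyDownFrom⁺₁ (conj (suc r)) (ℓ r) λ {x} x<ℓ →
    subst (1 ≤_) (sym (conj-suc-< r x x<ℓ)) (s≤s z≤n) ,
    (begin
      conj (suc r) x                  ≤⟨ conj-mono r<n x ⟩
      conj n x                        ≡⟨ countP-<-↑← x (applyDownFrom ℓ n) ⟨
      countP (x <?_) (part n)         ≤⟨ length-filter (x <?_) (part n) ⟩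
      length (part n)                 ≡⟨ cong length (∂-downFrom 0 g l) ⟨
      length m                        ∎)
    where open ≤-Reasoning

  T₀-LR : IsLRTableau g l m T₀
  T₀-LR =
    (length-applyUpTo minRow n ,
     All.applyUpTo⁺₂ id n λ r → trans (cong length (row-T₀ r)) (trans (length-applyDownFrom (conj (suc r)) (ℓ r)) (rowCount-0 g l r))) ,
    All.applyUpTo⁺₁ minRow n T₀-labels ,
    -- From left to right the number of cells to the right drops, so the labels weakly increase
    -- because `conj` is antitone.
    All.applyUpTo⁺₂ minRow n (λ r → Linked.applyDownFrom⁺₂ (conj (suc r)) (ℓ r) (λ x → conj-antitone (suc r) (n≤1+n x))) ,
    All.applyUpTo⁺₂ id n (λ r → All.universal (T₀-cols r) (range 0 (g !! r))) ,
    All.map⁺ (All.applyUpTo⁺₂ id (length m) λ b → subst (λ k → countP (k ≟_) (concat T₀) ≡ m !! (k ∸ 1)) (+-comm 1 b) (content b)) ,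
    Interlaced⇒Lattice (length m) T₀ λ r b →
      subst₂ _≤_ (sym (cumul-T₀ (suc r) (suc b))) (sym (cumul-T₀ r b)) (part-interlaced r b)
    where
    content : ∀ b → countP (suc b ≟_) (concat T₀) ≡ m !! b
    content b = begin
      countP (suc b ≟_) (concat T₀)         ≡⟨ countP-concat (suc b ≟_) T₀ ⟩
      cumul (labels T₀) (length T₀) b       ≡⟨ cong (λ k → cumul (labels T₀) k b) (length-applyUpTo minRow n) ⟩
      cumul (labels T₀) n b                 ≡⟨ cumul-T₀ n b ⟩
      part n !! b                           ≡⟨ cong (_!! b) (∂-downFrom 0 g l) ⟨
      m !! b                                ∎
      where open ≡-Reasoning

-- Uniqueness of the minimal tableau

!!≤⇒sum≤ : ∀ ys ν → (∀ b → ys !! b ≤ ν b) → sum ys ≤ Σ< (length ys) ν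
!!≤⇒sum≤ []       ν lower = z≤n
!!≤⇒sum≤ (y ∷ ys) ν lower = ≤-trans (+-mono-≤ (lower 0) (!!≤⇒sum≤ ys (ν ∘ suc) (lower ∘ suc)))
  (≤-reflexive (sym (Σ<-front (length ys) ν)))

-- A pointwise lower bound that already exhausts the total leaves no slack anywhere. Bounding every
-- `Σ< K ν` also forces `ν` to vanish beyond the end of `ys`.
lower∧total⇒≡ : ∀ ys ν → (∀ b → ys !! b ≤ ν b) → (∀ K → Σ< K ν ≤ sum ys) → ∀ b → ν b ≡ ys !! b
lower∧total⇒≡ []       ν lower total b = n≤0⇒n≡0 (≤-trans (m≤n+m (ν b) (Σ< b ν)) (total (suc b)))
lower∧total⇒≡ (y ∷ ys) ν lower total zero = ≤-antisym (+-cancelʳ-≤ (sum ys) (ν 0) y (begin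
  ν 0 + sum ys                              ≤⟨ +-monoʳ-≤ (ν 0) (!!≤⇒sum≤ ys (ν ∘ suc) (lower ∘ suc)) ⟩
  ν 0 + Σ< (length ys) (ν ∘ suc)            ≡⟨ Σ<-front (length ys) ν ⟨
  Σ< (suc (length ys)) ν                    ≤⟨ total (suc (length ys)) ⟩
  y + sum ys                                ∎)) (lower 0)
  where open ≤-Reasoning
lower∧total⇒≡ (y ∷ ys) ν lower total (suc b) = lower∧total⇒≡ ys (ν ∘ suc) (lower ∘ suc) (λ K → +-cancelˡ-≤ y _ _ (begin
  y + Σ< K (ν ∘ suc)                        ≤⟨ +-monoˡ-≤ _ (lower 0) ⟩
  ν 0 + Σ< K (ν ∘ suc)                      ≡⟨ Σ<-front K ν ⟨
  Σ< (suc K) ν                              ≤⟨ total (suc K) ⟩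
  y + sum ys                                ∎)) b
  where open ≤-Reasoning

-- Before the insertion position the upper bound and the dominance of ys determine ν;
-- from that position on, the lower bound and the total do.
insertDesc-interlacing-unique : ∀ x ys ν → (∀ b → insertDesc x ys !! suc b ≤ ν b) → (∀ b → ν b ≤ insertDesc x ys !! b) →
  (∀ j → Σ< j (ys !!_) ≤ Σ< j ν) → (∀ K → Σ< K ν ≤ sum ys) → ∀ b → ν b ≡ ys !! b
insertDesc-interlacing-unique x [] ν lower upper dom total = lower∧total⇒≡ [] ν (λ _ → z≤n) total
insertDesc-interlacing-unique x (y ∷ ys) ν lower upper dom total with y ≤? x
-- Here `x` is inserted in front, so the list bounding `ν` from below is `y ∷ ys` itself.
... | yes _ = lower∧total⇒≡ (y ∷ ys) ν lower total
... | no  _ = λ where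
    zero    → ν0≡y
    (suc b) → insertDesc-interlacing-unique x ys (ν ∘ suc) (lower ∘ suc) (upper ∘ suc)
      (λ j → +-cancelˡ-≤ y _ _ (subst₂ _≤_ (Σ<-front j ((y ∷ ys) !!_)) (front j) (dom (suc j))))
      (λ K → +-cancelˡ-≤ y _ _ (≤-trans (≤-reflexive (sym (front K))) (total (suc K)))) b
  where
  ν0≡y : ν 0 ≡ y
  ν0≡y = ≤-antisym (upper 0) (dom 1)
  front : ∀ j → Σ< (suc j) ν ≡ y + Σ< j (ν ∘ suc)
  front j = trans (Σ<-front j ν) (cong (_+ Σ< j (ν ∘ suc)) ν0≡y)

countP-self : ∀ x xs → countP (x ≟_) (x ∷ xs) ≡ suc (countP (x ≟_) xs)
countP-self x xs = cong length (filter-accept (x ≟_) refl)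

-- Each head occurs in the other list, whose own head is its minimum; hence the heads agree and can
-- be cancelled from all counts.
sorted-counts-≡ : ∀ {xs ys} → Linked _≤_ xs → Linked _≤_ ys → (∀ v → countP (v ≟_) xs ≡ countP (v ≟_) ys) → xs ≡ ys
sorted-counts-≡ {[]}     {[]}     l l′ h = refl
sorted-counts-≡ {[]}     {y ∷ ys} l l′ h with () ← trans (h y) (countP-self y ys)
sorted-counts-≡ {x ∷ xs} {[]}     l l′ h with () ← trans (sym (h x)) (countP-self x xs)
sorted-counts-≡ {x ∷ xs} {y ∷ ys} l l′ h with ≤-antisym (head≤ l′ (trans (sym (h x)) (countP-self x xs)))
                                                       (head≤ l (trans (h y) (countP-self y ys)))
  where
  head≤ : ∀ {v z zs k} → Linked _≤_ (z ∷ zs) → countP (v ≟_) (z ∷ zs) ≡ suc k → z ≤ v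
  head≤ {v} {z} l e = ≮⇒≥ λ v<z → contradiction
    (trans (sym e) (countP-none (v ≟_) (All.map (λ { z≤w refl → <⇒≱ v<z z≤w }) (Linked⇒All ≤-trans ≤-refl l)))) λ ()
... | refl = cong (x ∷_) (sorted-counts-≡ (Linked.tail l) (Linked.tail l′) λ v →
  +-cancelˡ-≡ [ v ≟ x ] _ _ (trans (sym (countP-∷ (v ≟_) x xs)) (trans (h v) (countP-∷ (v ≟_) x ys))))

rows-≡ : ∀ {T T′} → length T ≡ length T′ → (∀ r → row T r ≡ row T′ r) → T ≡ T′
rows-≡ {[]}    {[]}     e h = refl
rows-≡ {_ ∷ _} {_ ∷ _} e h = cong₂ _∷_ (h 0) (rows-≡ (suc-injective e) (h ∘ suc))

-- Label counts forced by the content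

module Unique-LR {g l T} (pg : IsPartition g) (pl : IsPartition l) (t : IsLRTableau g l (∂ 0 g l) T) where

  open Tableau {m = ∂ 0 g l} {T = T} pg pl t
  open Minimal (rowCount 0 g l)

  private
    m = ∂ 0 g l

    dominates : ∀ r j → Σ< j (part r !!_) ≤ Σ< j (cumul (labels T) r)
    dominates r j = ≤-trans (≤-reflexive (Σ<-!! j (part r)))
      (top-rows≤cumul (labels T) (rowCount 0 g l) interlaced (λ r → length m , (begin
        rowCount 0 g l r                                  ≤⟨ rowCount≤labels-above 0 r ⟩
        countP (0 <?_) (row T r)                          ≤⟨ labels-above≤ 0 r ⟩
        Σ< (length m) (λ t → labels T r (t + 0))          ≡⟨ Σ<-cong (length m) (λ t → cong (labels T r) (+-identityʳ t)) ⟩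
        Σ< (length m) (labels T r)                        ∎)) r j)
      where open ≤-Reasoning

    -- Each row adds at most as many labels as it has cells, and `part` grows by exactly that
    -- number.
    total : ∀ r K → Σ< K (cumul (labels T) r) ≤ sum (part r)
    total zero    K = ≤-reflexive (Σ<-0 K)
    total (suc r) K = begin
      Σ< K (cumul (labels T) (suc r))                       ≡⟨ Σ<-+ K _ _ ⟩
      Σ< K (cumul (labels T) r) + Σ< K (labels T r)         ≤⟨ +-mono-≤ (total r K) (Σ<-countP≤length K (row T r)) ⟩
      sum (part r) + length (row T r)                       ≡⟨ cong (sum (part r) +_) (trans (length-row r) (sym (rowCount-0 g l r))) ⟩
      sum (part r) + rowCount 0 g l r                       ≡⟨ +-comm (sum (part r)) _ ⟩
      rowCount 0 g l r + sum (part r)                       ≡⟨ sum-part-suc r ⟨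
      sum (part (suc r))                                    ∎
      where open ≤-Reasoning

    -- Interlacing and growth place the content of `r` rows between the known content of `r + 1`
    -- rows, shifted and unshifted; with `dominates` and `total` this leaves only the removal of one
    -- part. An empty row changes neither side.
    descend : ∀ r → (∀ b → cumul (labels T) (suc r) b ≡ part (suc r) !! b) → ∀ b → cumul (labels T) r b ≡ part r !! b
    descend r h with 1 ≤? rowCount 0 g l r
    ... | no  ℓ≡0 = λ b → begin
      cumul (labels T) r b                  ≡⟨ +-identityʳ _ ⟨
      cumul (labels T) r b + 0              ≡⟨ cong (λ xs → cumul (labels T) r b + countP (suc b ≟_) xs) row≡[] ⟨
      cumul (labels T) (suc r) b            ≡⟨ h b ⟩
      part (suc r) !! b                     ≡⟨ cong (_!! b) (↑←-reject (applyDownFrom (rowCount 0 g l) r) ℓ≡0) ⟩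
      part r !! b                           ∎
      where
      open ≡-Reasoning
      length-0 : ∀ {xs : List ℕ} → length xs ≡ 0 → xs ≡ []
      length-0 {[]} _ = refl
      row≡[] : row T r ≡ []
      row≡[] = length-0 (trans (length-row r) (trans (sym (rowCount-0 g l r)) (n<1⇒n≡0 (≰⇒> ℓ≡0))))
    ... | yes 1≤ℓ = insertDesc-interlacing-unique (rowCount 0 g l r) (part r) (cumul (labels T) r)
      (λ b → subst (_≤ cumul (labels T) r b) (next (suc b)) (interlaced r b))
      (λ b → subst (cumul (labels T) r b ≤_) (next b) (m≤m+n _ _))
      (dominates r) (total r)
      where
      next : ∀ b → cumul (labels T) (suc r) b ≡ insertDesc (rowCount 0 g l r) (part r) !! b
      next b = trans (h b) (cong (_!! b) (↑←-accept (applyDownFrom (rowCount 0 g l) r) 1≤ℓ))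

  cumul-forced : ∀ {r} → r ≤ length g → ∀ b → cumul (labels T) r b ≡ part r !! b
  cumul-forced {r} r≤n = from-below (length g ∸ r) (m+[n∸m]≡n r≤n)
    where
    -- Induction on the number `k` of rows not among the first `r`; for `k = 0` the given content of
    -- the whole tableau is the starting point.
    from-below : ∀ {r} k → r + k ≡ length g → ∀ b → cumul (labels T) r b ≡ part r !! b
    from-below {r} zero e b rewrite trans (sym (+-identityʳ r)) e =
      trans (cumul-content b) (cong (_!! b) (∂-downFrom 0 g l))
    from-below {r} (suc k) e = descend r (from-below k (trans (sym (+-suc r k)) e))

  labels-forced : ∀ {r} → r < length g → ∀ b → part r !! b + labels T r b ≡ part (suc r) !! b
  labels-forced {r} r<n b = trans (cong (_+ labels T r b) (sym (cumul-forced (<⇒≤ r<n) b))) (cumul-forced r<n b)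

  -- `labels` counts positive labels only, whereas `sorted-counts-≡` compares the counts of all
  -- values.
  no-label-0 : ∀ r → countP (0 ≟_) (row T r) ≡ 0
  no-label-0 r = countP-none (0 ≟_) (All.map (λ { (p , _) refl → 1+n≰n p }) (row-All (proj₁ (proj₂ t)) r))

-- The count of each label in a row is the difference of two consecutive forced contents, and a
-- weakly increasing row is determined by its counts.
LR-unique : ∀ {g l T T′} → IsPartition g → IsPartition l →
  IsLRTableau g l (∂ 0 g l) T → IsLRTableau g l (∂ 0 g l) T′ → T ≡ T′
LR-unique {g} {l} {T} {T′} pg pl t t′ = rows-≡ (trans (proj₁ (proj₁ t)) (sym (proj₁ (proj₁ t′)))) same-row
  where
  module U  = Unique-LR {T = T} pg pl t
  module U′ = Unique-LR {T = T′} pg pl t′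
  module L  = Tableau {m = ∂ 0 g l} {T = T} pg pl t
  module L′ = Tableau {m = ∂ 0 g l} {T = T′} pg pl t′
  open Minimal (rowCount 0 g l)
  same-row : ∀ r → row T r ≡ row T′ r
  same-row r with r <? length g
  ... | no  r≮n = trans (L.row-overflow r (≮⇒≥ r≮n)) (sym (L′.row-overflow r (≮⇒≥ r≮n)))
  ... | yes r<n = sorted-counts-≡ (L.rows-weak r) (L′.rows-weak r) λ where
    zero    → trans (U.no-label-0 r) (sym (U′.no-label-0 r))
    (suc b) → +-cancelˡ-≡ (part r !! b) _ _ (trans (U.labels-forced r<n b) (sym (U′.labels-forced r<n b)))

-- Counting tableaux in the enumeration of fillings

-- Brings the enumerations into the form of a cartesian product, through which membership and
-- absence of duplicates pass from the factors.
concatMap-cons : ∀ {A : Set} (xs : List A) (ys : List (List A)) →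
  concatMap (λ x → map (x ∷_) ys) xs ≡ cartesianProductWith _∷_ xs ys
concatMap-cons []       ys = refl
concatMap-cons (x ∷ xs) ys = cong (map (x ∷_) ys ++_) (concatMap-cons xs ys)

words-unique : ∀ n k → Unique (words n k)
words-unique zero    k = [] ∷ []
words-unique (suc n) k rewrite concatMap-cons (range 0 k) (words n k) =
  cartesianProductWith⁺ _∷_ ∷-injective (Unique.map⁺ (+-cancelʳ-≡ 1 _ _) (upTo⁺ k)) (words-unique n k)

∈-words : ∀ {k} xs → All (λ x → 1 ≤ x × x ≤ k) xs → xs ∈ words (length xs) k
∈-words         []       a = here refl
∈-words {k} (suc x ∷ xs) ((s≤s p , q) ∷ a) rewrite concatMap-cons (range 0 k) (words (length xs) k) =
  ∈-cartesianProductWith⁺ _∷_ (subst (_∈ range 0 k) (+-comm x 1) (∈-map⁺ (_+ 1) (∈-upTo⁺ q))) (∈-words xs a)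

fillingsFrom-unique : ∀ g l k r n → Unique (fillingsFrom g l k r n)
fillingsFrom-unique g l k r zero    = [] ∷ []
fillingsFrom-unique g l k r (suc n)
  rewrite concatMap-cons (words (g !! r ∸ l !! r) k) (fillingsFrom g l k (suc r) n) =
  cartesianProductWith⁺ _∷_ ∷-injective (words-unique (g !! r ∸ l !! r) k) (fillingsFrom-unique g l k (suc r) n)

∈-fillingsFrom : ∀ g l k r T → All (All (λ x → 1 ≤ x × x ≤ k)) T →
  (∀ s → s < length T → length (row T s) ≡ g !! (s + r) ∸ l !! (s + r)) → T ∈ fillingsFrom g l k r (length T)
∈-fillingsFrom g l k r []      a       shape = here refl
∈-fillingsFrom g l k r (x ∷ T) (b ∷ a) shape
  rewrite concatMap-cons (words (g !! r ∸ l !! r) k) (fillingsFrom g l k (suc r) (length T)) =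
  ∈-cartesianProductWith⁺ _∷_
    (subst (λ n → x ∈ words n k) (shape 0 (s≤s z≤n)) (∈-words x b))
    (∈-fillingsFrom g l k (suc r) T a λ s s<n →
      trans (shape (suc s) (s≤s s<n)) (cong (λ q → g !! q ∸ l !! q) (sym (+-suc s r))))

LR-∈-fillings : ∀ {g l m T} → IsLRTableau g l m T → T ∈ fillings g l (length m)
LR-∈-fillings {g} {l} {m} {T} ((len , shape) , labelled , _) =
  subst (λ n → T ∈ fillingsFrom g l (length m) 0 n) len (∈-fillingsFrom g l (length m) 0 T labelled λ s s<n →
    trans (All.applyUpTo⁻ id (length g) shape (subst (s <_) len s<n)) (cong (λ q → g !! q ∸ l !! q) (sym (+-identityʳ s))))

-- Without duplicates, a second entry after filtering would differ from the first, yet both would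
-- equal `a`.
length-filter-unique : ∀ {A : Set} {P : A → Set} (P? : ∀ x → Dec (P x)) {xs a} → Unique xs →
  a ∈ xs → P a → (∀ b → P b → b ≡ a) → length (filter P? xs) ≡ 1
length-filter-unique P? {xs} {a} u a∈ pa only = singleton (filter P? xs) (Unique.filter⁺ P? u) (∈-filter⁺ P? a∈ pa)
  (λ b b∈ → only b (proj₂ (∈-filter⁻ P? {xs = xs} b∈)))
  where
  singleton : ∀ ys → Unique ys → a ∈ ys → (∀ b → b ∈ ys → b ≡ a) → length ys ≡ 1
  singleton (_ ∷ [])        _             _ _    = refl
  singleton (y ∷ y′ ∷ _) ((y≢y′ ∷ _) ∷ _) _ only =
    contradiction (trans (only y (here refl)) (sym (only y′ (there (here refl))))) y≢y′

LR≢0⇒tableau : ∀ g l m → LR g l m ≢ 0 → ∃ (IsLRTableau g l m)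
LR≢0⇒tableau g l m ≢0 with filter (isLRTableau? g l m) (fillings g l (length m)) in eq
... | []    = contradiction refl ≢0
... | T ∷ _ = T , proj₂ (∈-filter⁻ (isLRTableau? g l m) {xs = fillings g l (length m)} (subst (T ∈_) (sym eq) (here refl)))

theorem3p1 : (γ λ' : List ℕ) → IsPartition γ → IsPartition λ' → λ' ⊆ₚ γ →
    ((μ : List ℕ) → IsPartition μ → LR γ λ' μ ≢ 0 →
    (i : ℕ) → 1 ≤ i → ∂ i γ λ' ≤GDom drop i μ)
    × (LR γ λ' (∂ 0 γ λ') ≡ 1)
    × ((μ : List ℕ) → IsPartition μ → LR γ λ' μ ≢ 0 → ∂ 0 γ λ' ≤GDom μ)
theorem3p1 γ λ' pγ pλ _ =
  (λ μ _ c≢0 i _ → Tableau.∂≤GDom {m = μ} pγ pλ (proj₂ (LR≢0⇒tableau γ λ' μ c≢0)) i) ,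
  -- Existence comes from `T₀`, and `LR-unique` identifies every other tableau with it.
  length-filter-unique (isLRTableau? γ λ' (∂ 0 γ λ')) (fillingsFrom-unique γ λ' _ 0 (length γ))
    (LR-∈-fillings {γ} {λ'} {∂ 0 γ λ'} T₀-LR) T₀-LR (λ T t → LR-unique {T = T} pγ pλ t T₀-LR) ,
  -- The dominance for `i = 0`, where `drop 0 μ` is `μ`.
  (λ μ _ c≢0 → Tableau.∂≤GDom {m = μ} pγ pλ (proj₂ (LR≢0⇒tableau γ λ' μ c≢0)) 0)
  where open MinimalTableau pγ pλ
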